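{- Suppose $0<\beta\ll\alpha\ll 1$ and $n$ is sufficiently large; that is, there is $\alpha_0>0$ such that for every $0<\alpha\le\alpha_0$ there is $\beta_0>0$ such that for every $0<\beta\le\beta_0$ there is $n_0$ such that for all $n\ge n_0$ the following holds. Let $G$ be a $3$-connected graph on $n$ vertices with $\delta(G)\ge (2n+3)/5$. If there is a partition $V(G)=V_1\cup V_2$ with $|V_i|\ge (2/5-4\beta)n$ for $i=1,2$, $d(V_1,V_2)<\alpha$, and $\deg(v_1,V_2)\le 2\beta n$ for every $v_1\in V_1$, then $G$ contains a spanning generalized Halin graph.
   Context: All graphs are finite and simple. $\deg(v,S)$ is the number of neighbors of $v$ in $S$; $d(V_1,V_2)=e(V_1,V_2)/(|V_1||V_2|)$ where $e(V_1,V_2)$ is the number of edges with one end in $V_1$ and the other in $V_2$. For a tree $T$, $L(T)$ is its set of leaves; a HIST of $G$ is a spanning tree with no vertex of degree $2$; a spanning generalized Halin graph of $G$ is a spanning subgraph $T\cup C$ of $G$ with $T$ a HIST of $G$ and $C$ a cycle of $G$ with $V(C)=L(T)$. -}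

module Defs where

open import Data.Nat using (ℕ; zero; suc; _+_; _*_; _≤_; _<_)
open import Data.Fin using (Fin; zero; suc)
open import Data.Bool using (Bool; true; false; not; _∧_; if_then_else_)
open import Data.List using (List; []; _∷_; length; _++_)
open import Data.List.Membership.Propositional using (_∈_)
open import Data.List.Relation.Unary.Unique.Propositional using (Unique)
open import Data.Product using (Σ; _×_)
open import Data.Unit using (⊤)
open import Data.Empty using (⊥)
open import Relation.Nullary using (¬_)
open import Relation.Binary.PropositionalEquality using (_≡_; _≢_)
open import Function.Bundles using (_⇔_)

record Graph (n : ℕ) : Set where
  field
    adj    : Fin n → Fin n → Bool
    sym    : ∀ u v → adj u v ≡ adj v u
    irrefl : ∀ v → adj v v ≡ false
open Graph public

VSet : ℕ → Set
VSet n = Fin n → Bool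

sumFin : ∀ {n} → (Fin n → ℕ) → ℕ
sumFin {zero}  f = 0
sumFin {suc n} f = f zero + sumFin (λ i → f (suc i))

count : ∀ {n} → VSet n → ℕ
count p = sumFin (λ i → if p i then 1 else 0)

size : ∀ {n} → VSet n → ℕ
size = count

compl : ∀ {n} → VSet n → VSet n
compl S v = not (S v)

degIn : ∀ {n} → Graph n → Fin n → VSet n → ℕ
degIn G v S = count (λ u → S u ∧ adj G v u)

degree : ∀ {n} → Graph n → Fin n → ℕ
degree G v = count (adj G v)

-- e(S, V∖S): number of edges with one end in S and the other in the complement
-- (for disjoint sets each such edge is counted exactly once from its S-end).
eBetween : ∀ {n} → Graph n → VSet n → ℕ
eBetween G S = sumFin (λ u → if S u then degIn G u (compl S) else 0)

data Walk {n} (G : Graph n) (W : VSet n) : Fin n → Fin n → Set where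
  here : ∀ {v} → W v ≡ true → Walk G W v v
  step : ∀ {u v w} → W u ≡ true → adj G u v ≡ true → Walk G W v w → Walk G W u w

ConnectedOn : ∀ {n} → Graph n → VSet n → Set
ConnectedOn G W = ∀ u v → W u ≡ true → W v ≡ true → Walk G W u v

Connected : ∀ {n} → Graph n → Set
Connected G = ConnectedOn G (λ _ → true)

KConnected : ∀ {n} → ℕ → Graph n → Set
KConnected {n} k G = (k < n) × (∀ (S : VSet n) → size S < k → ConnectedOn G (compl S))

PathAdj : ∀ {n} → Graph n → List (Fin n) → Set
PathAdj G []            = ⊤
PathAdj G (x ∷ [])      = ⊤
PathAdj G (x ∷ y ∷ r)   = (adj G x y ≡ true) × PathAdj G (y ∷ r)

IsCycle : ∀ {n} → Graph n → List (Fin n) → Set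
IsCycle G []      = ⊥
IsCycle G (v ∷ r) = (3 ≤ length (v ∷ r)) × Unique (v ∷ r) × PathAdj G ((v ∷ r) ++ (v ∷ []))

-- T is a subgraph of G (on the same vertex set, hence spanning)
Subgraph : ∀ {n} → Graph n → Graph n → Set
Subgraph {n} T G = ∀ (u v : Fin n) → adj T u v ≡ true → adj G u v ≡ true

IsTree : ∀ {n} → Graph n → Set
IsTree {n} T = Connected T × (∀ (vs : List (Fin n)) → ¬ IsCycle T vs)

IsLeaf : ∀ {n} → Graph n → Fin n → Set
IsLeaf T v = degree T v ≡ 1

IsHIST : ∀ {n} → Graph n → Graph n → Set
IsHIST {n} G T = Subgraph T G × IsTree T × (∀ (v : Fin n) → degree T v ≢ 2)

HasSpanningGenHalin : ∀ {n} → Graph n → Set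
HasSpanningGenHalin {n} G =
  Σ (Graph n) λ T → Σ (List (Fin n)) λ C →
    IsHIST G T × IsCycle G C × (∀ (v : Fin n) → (v ∈ C) ⇔ IsLeaf T v)

{-# OPTIONS --safe #-}
-- Move the vertices of V₂ with most of their neighbours in V₁ to the other side.  Then every vertex keeps
-- at least n/10 neighbours on its own side, and all but n/1000 of them keep 39n/100, while a side has at most
-- 61n/100 vertices.  By 3-connectivity there are three disjoint edges A A′, B B′, x₃ y₃ across.  Around x₃ y₃
-- one grows a connected set S of at most n/100 vertices that dominates the graph, contains all exceptional
-- vertices and avoids A, A′, B, B′.  S spans a tree; attaching all other vertices to it as leaves, at least
-- three per vertex of S, gives a HIST with leaf set V ∖ S.  On each side the leaves satisfy Ore's condition
-- for Hamilton-connectedness, and the edges A A′ and B B′ close the two Hamilton paths to a cycle.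
module Submission where

open import Defs hiding (sym)

-- Tree and cycle compete for the edges between the two sides, of which there may be few: the cycle
-- has to cross twice, on leaves, and the tree once. Disjoint edges separate these tasks, and
-- 3-connectivity supplies just the three that are needed. The core has conflicting duties as well.
-- It must dominate, yet leave almost every neighbourhood intact. Linear minimum degree reconciles
-- them: a dominating set needs only a small fraction of the vertices. The numbers 39 and 61 leave a
-- slack of 2 * 39 - 61 = 17 hundredths of n, which is spent twice. It gives any two ordinary
-- vertices of a side a common neighbour, so that each vertex wanted in the core costs at most
-- three; and it lets Ore's condition survive the deletion of the core. Exceptional vertices have no
-- such slack. Inside the core only their total degree matters, which is why they go there. The four
-- reserved ends cannot go there and may be exceptional too; they sit at the ends of the Hamilton
-- paths, where a single suitable neighbour on their own side is enough.

module Halin where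

  open import Data.Bool using (Bool; true; false; not; _∧_; _∨_; if_then_else_)
  import Data.Bool
  open import Data.Bool.Properties using (∧-comm; ∨-comm; ∨-identityʳ; ∧-identityʳ)
  open import Data.Empty using (⊥; ⊥-elim)
  open import Data.Fin using (Fin; zero; suc)
  import Data.Fin as Fin
  open import Data.List using (List; []; _∷_; length; _++_)
  import Data.List as List
  open import Data.List.Membership.Propositional using (_∈_)
  open import Data.List.Relation.Unary.All using (All; []; _∷_)
  import Data.List.Relation.Unary.All as All
  open import Data.List.Relation.Unary.AllPairs using ([]; _∷_)
  open import Data.List.Relation.Unary.Any using (here; there)
  open import Data.List.Relation.Unary.Unique.Propositional using (Unique)
  open import Data.Nat
  open import Data.Nat.Properties
  open import Data.Nat.Tactic.RingSolver using (solve-∀)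
  open import Data.Product using (Σ; _×_; _,_; proj₁; proj₂; ∃)
  open import Data.Sum using (_⊎_; inj₁; inj₂)
  open import Data.Unit using (⊤)
  open import Function using (_∘_)
  open import Function.Bundles using (mk⇔)
  open import Relation.Binary.PropositionalEquality
  open import Relation.Nullary using (¬_; yes; no; does)
  open import Relation.Nullary.Decidable using (dec-true; dec-false)

  private variable
    n m : ℕ

  -- Sets of vertices and counting

  infixr 7 _∩_ _∖_
  infixr 6 _∪_

  _∩_ _∪_ _∖_ : VSet n → VSet n → VSet n
  (p ∩ q) v = p v ∧ q v
  (p ∪ q) v = p v ∨ q v
  p ∖ q = p ∩ compl q

  ∧-true⁻ : ∀ {a b} → a ∧ b ≡ true → (a ≡ true) × (b ≡ true)
  ∧-true⁻ {true} {true} _ = refl , refl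

  ∧-true⁺ : ∀ {a b} → a ≡ true → b ≡ true → a ∧ b ≡ true
  ∧-true⁺ refl refl = refl

  ∨-true⁻ : ∀ {a b} → a ∨ b ≡ true → (a ≡ true) ⊎ (b ≡ true)
  ∨-true⁻ {true}  _ = inj₁ refl
  ∨-true⁻ {false} e = inj₂ e

  ∨-true⁺ˡ : ∀ {a b} → a ≡ true → a ∨ b ≡ true
  ∨-true⁺ˡ refl = refl

  ∨-true⁺ʳ : ∀ {a b} → b ≡ true → a ∨ b ≡ true
  ∨-true⁺ʳ {true}  _ = refl
  ∨-true⁺ʳ {false} e = e

  ∨-false⁻ : ∀ {a b} → a ∨ b ≡ false → (a ≡ false) × (b ≡ false)
  ∨-false⁻ {false} {false} _ = refl , refl

  true≢false : ∀ {a} → a ≡ true → a ≡ false → ⊥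
  true≢false refl ()

  bool-cases : ∀ b → (b ≡ true) ⊎ (b ≡ false)
  bool-cases true  = inj₁ refl
  bool-cases false = inj₂ refl

  not-true⁻ : ∀ {a} → not a ≡ true → a ≡ false
  not-true⁻ {false} _ = refl

  not-true⁺ : ∀ {a} → a ≡ false → not a ≡ true
  not-true⁺ refl = refl

  _==_ : Fin n → Fin n → Bool
  x == y = does (x Fin.≟ y)

  ==-refl : (x : Fin n) → (x == x) ≡ true
  ==-refl x = dec-true (x Fin.≟ x) refl

  ==⇒≡ : {x y : Fin n} → (x == y) ≡ true → x ≡ y
  ==⇒≡ {x = x} {y} e with x Fin.≟ y
  ... | yes x≡y = x≡y

  ≢⇒== : {x y : Fin n} → x ≢ y → (x == y) ≡ false
  ≢⇒== {x = x} {y} = dec-false (x Fin.≟ y)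

  ==-false⇒≢ : {x y : Fin n} → (x == y) ≡ false → x ≢ y
  ==-false⇒≢ {x = x} e refl = true≢false (==-refl x) e

  [_]? : Bool → ℕ
  [ b ]? = if b then 1 else 0

  []?-mono : ∀ {a b} → (a ≡ true → b ≡ true) → [ a ]? ≤ [ b ]?
  []?-mono {false} _ = z≤n
  []?-mono {true}  h rewrite h refl = ≤-refl

  []?≤1 : ∀ b → [ b ]? ≤ 1
  []?≤1 true  = ≤-refl
  []?≤1 false = z≤n

  sum-cong : {f g : Fin n → ℕ} → (∀ i → f i ≡ g i) → sumFin f ≡ sumFin g
  sum-cong {zero}  h = refl
  sum-cong {suc _} h = cong₂ _+_ (h zero) (sum-cong (λ i → h (suc i)))

  sum-mono : {f g : Fin n → ℕ} → (∀ i → f i ≤ g i) → sumFin f ≤ sumFin g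
  sum-mono {zero}  h = z≤n
  sum-mono {suc _} h = +-mono-≤ (h zero) (sum-mono (λ i → h (suc i)))

  sum-+ : (f g : Fin n → ℕ) → sumFin (λ i → f i + g i) ≡ sumFin f + sumFin g
  sum-+ {zero}  f g = refl
  sum-+ {suc _} f g rewrite sum-+ (λ i → f (suc i)) (λ i → g (suc i)) =
    interchange (f zero) (g zero) _ _
    where
    interchange : ∀ a b c d → (a + b) + (c + d) ≡ (a + c) + (b + d)
    interchange = solve-∀

  sum-*ʳ : ∀ c (f : Fin n → ℕ) → sumFin (λ i → f i * c) ≡ sumFin f * c
  sum-*ʳ {zero}  c f = refl
  sum-*ʳ {suc _} c f rewrite sum-*ʳ c (λ i → f (suc i)) = sym (*-distribʳ-+ c (f zero) _)

  sum-const : ∀ c → sumFin {n} (λ _ → c) ≡ n * c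
  sum-const {zero}  c = refl
  sum-const {suc n} c = cong (c +_) (sum-const {n} c)

  sum-swap : (f : Fin n → Fin m → ℕ) →
    sumFin (λ i → sumFin (f i)) ≡ sumFin (λ j → sumFin (λ i → f i j))
  sum-swap {zero} {m} f = sym (trans (sum-const {m} 0) (*-zeroʳ m))
  sum-swap {suc n} f rewrite sum-swap (λ i → f (suc i)) = sym (sum-+ (f zero) _)

  count-cong : (p q : VSet n) → (∀ i → p i ≡ q i) → count p ≡ count q
  count-cong p q h = sum-cong (λ i → cong [_]? (h i))

  count-mono : (p q : VSet n) → (∀ i → p i ≡ true → q i ≡ true) → count p ≤ count q
  count-mono p q h = sum-mono (λ i → []?-mono (h i))

  count-true : count {n} (λ _ → true) ≡ n
  count-true {n} = trans (sum-const {n} 1) (*-identityʳ n)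

  count≤n : (p : VSet n) → count p ≤ n
  count≤n {n} p = subst (count p ≤_) (count-true {n}) (count-mono p _ (λ _ _ → refl))

  count-split : (p q : VSet n) → count p ≡ count (p ∩ q) + count (p ∖ q)
  count-split p q = trans (sum-cong (λ i → pointwise (p i) (q i))) (sum-+ (λ i → [ (p ∩ q) i ]?) _)
    where
    pointwise : ∀ a b → [ a ]? ≡ [ a ∧ b ]? + [ a ∧ not b ]?
    pointwise true true   = refl
    pointwise true false  = refl
    pointwise false _     = refl

  count-compl : (p : VSet n) → count p + count (compl p) ≡ n
  count-compl p = trans (sym (count-split (λ _ → true) p)) count-true

  count-∪ : (p q : VSet n) → count (p ∪ q) ≤ count p + count q
  count-∪ p q = ≤-trans (sum-mono (λ i → pointwise (p i) (q i))) (≤-reflexive (sum-+ (λ i → [ p i ]?) _))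
    where
    pointwise : ∀ a b → [ a ∨ b ]? ≤ [ a ]? + [ b ]?
    pointwise true  b = s≤s z≤n
    pointwise false b = ≤-refl

  count-∖ : (p q : VSet n) → count p ≤ count (p ∖ q) + count q
  count-∖ p q rewrite count-split p q | +-comm (count (p ∩ q)) (count (p ∖ q)) =
    +-monoʳ-≤ (count (p ∖ q)) (count-mono (p ∩ q) q (λ i e → proj₂ (∧-true⁻ {p i} e)))

  count-∩ : (p q u : VSet n) → (∀ i → p i ≡ true → u i ≡ true) → (∀ i → q i ≡ true → u i ≡ true) →
    count p + count q ≤ count u + count (p ∩ q)
  count-∩ p q u p⊆u q⊆u = subst₂ _≤_ (sum-+ (λ i → [ p i ]?) _) (sum-+ (λ i → [ u i ]?) _)
    (sum-mono (λ i → pointwise (p i) (q i) (u i) (p⊆u i) (q⊆u i)))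
    where
    pointwise : ∀ a b c → (a ≡ true → c ≡ true) → (b ≡ true → c ≡ true) → [ a ]? + [ b ]? ≤ [ c ]? + [ a ∧ b ]?
    pointwise true  true  c h k rewrite h refl = ≤-refl
    pointwise true  false c h k rewrite h refl = ≤-refl
    pointwise false true  c h k rewrite k refl = ≤-refl
    pointwise false false c h k = z≤n

  find : (p : VSet n) → (∃ λ i → p i ≡ true) ⊎ (∀ i → p i ≡ false)
  find {zero} p = inj₂ (λ ())
  find {suc n} p with bool-cases (p zero) | find (λ i → p (suc i))
  ... | inj₁ e | _            = inj₁ (zero , e)
  ... | inj₂ _ | inj₁ (i , e) = inj₁ (suc i , e)
  ... | inj₂ e | inj₂ h       = inj₂ λ { zero → e ; (suc i) → h i }

  pick : (p q : VSet n) → count q < count p → ∃ λ i → (p i ≡ true) × (q i ≡ false)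
  pick p q q<p with find (p ∖ q)
  ... | inj₁ (i , e) = i , proj₁ (∧-true⁻ e) , not-true⁻ (proj₂ (∧-true⁻ {p i} e))
  ... | inj₂ none    = ⊥-elim (<⇒≱ q<p (count-mono p q p⊆q))
    where
    p⊆q : ∀ i → p i ≡ true → q i ≡ true
    p⊆q i pi with bool-cases (q i)
    ... | inj₁ e = e
    ... | inj₂ e = ⊥-elim (true≢false (∧-true⁺ pi (not-true⁺ e)) (none i))

  count-single : (v : Fin n) (f : VSet n) → count (λ w → (v == w) ∧ f w) ≡ [ f v ]?
  count-single {suc n} zero f = trans (cong ([ f zero ]? +_) (trans (sum-const {n} 0) (*-zeroʳ n))) (+-identityʳ _)
  count-single {suc n} (suc v) f = count-single v (λ i → f (suc i))

  mem : List (Fin n) → VSet n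
  mem []       v = false
  mem (x ∷ xs) v = (x == v) ∨ mem xs v

  mem-head : (x : Fin n) (xs : List (Fin n)) → mem (x ∷ xs) x ≡ true
  mem-head x xs = ∨-true⁺ˡ (==-refl x)

  mem-∷ : ∀ (x : Fin n) xs {v} → mem xs v ≡ true → mem (x ∷ xs) v ≡ true
  mem-∷ x xs {v} = ∨-true⁺ʳ {x == v}

  mem-∷⁻ : ∀ (x : Fin n) xs {v} → mem (x ∷ xs) v ≡ true → (x ≡ v) ⊎ (mem xs v ≡ true)
  mem-∷⁻ x xs {v} e with ∨-true⁻ {x == v} e
  ... | inj₁ h = inj₁ (==⇒≡ h)
  ... | inj₂ h = inj₂ h

  ∉-∷⁻ : ∀ (x : Fin n) xs {v} → mem (x ∷ xs) v ≡ false → (v ≢ x) × (mem xs v ≡ false)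
  ∉-∷⁻ x xs {v} e with ∨-false⁻ {x == v} e
  ... | h , k = (λ v≡x → ==-false⇒≢ h (sym v≡x)) , k

  ∉-∷⁺ : ∀ (x : Fin n) xs {v} → v ≢ x → mem xs v ≡ false → mem (x ∷ xs) v ≡ false
  ∉-∷⁺ x xs h k rewrite ≢⇒== (λ e → h (sym e)) = k

  count-mem : (xs : List (Fin n)) → count (mem xs) ≤ length xs
  count-mem {n} [] = ≤-reflexive (trans (sum-const {n} 0) (*-zeroʳ n))
  count-mem (x ∷ xs) = ≤-trans (count-∪ (x ==_) (mem xs)) (+-mono-≤ single (count-mem xs))
    where
    single : count (x ==_) ≤ 1
    single = ≤-trans (count-mono (x ==_) _ (λ i e → ∧-true⁺ e refl)) (≤-reflexive (count-single x (λ _ → true)))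

  pick∉ : (p : VSet n) (xs : List (Fin n)) → length xs < count p → ∃ λ v → (p v ≡ true) × (mem xs v ≡ false)
  pick∉ p xs h = pick p (mem xs) (≤-<-trans (count-mem xs) h)

  -- Linear arithmetic by certificates: the identity, with slack e, is left to the ring solver.
  linear : ∀ k .{{_ : NonZero k}} {A B L R e} → A ≤ B → R * k + A ≡ L * k + B + e → L ≤ R
  linear k {A} {B} {L} {R} {e} A≤B id = *-cancelʳ-≤ L R k (+-cancelʳ-≤ B _ _ (begin
    L * k + B      ≤⟨ m≤m+n _ e ⟩
    L * k + B + e  ≡⟨ id ⟨
    R * k + A      ≤⟨ +-monoʳ-≤ (R * k) A≤B ⟩
    R * k + B      ∎))
    where open ≤-Reasoning

  count-mem-∪ : (xs : List (Fin n)) (p : VSet n) → count (mem xs ∪ p) ≤ length xs + count p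
  count-mem-∪ xs p = ≤-trans (count-∪ (mem xs) p) (+-monoˡ-≤ (count p) (count-mem xs))

  -- Hamiltonian paths

  private variable
    a b c d : Fin n

  -- Consecutive vertices need not be adjacent: the Hamilton path is obtained from an arbitrary
  -- ordering by repairing the non-adjacent pairs, which `bad` counts. The indices keep the two ends
  -- fixed through all repairs.
  data Seg {n} : Fin n → Fin n → Set where
    end : ∀ a → Seg a a
    _∷_ : ∀ a {b c} → Seg b c → Seg a c

  _⧺_ : Seg a b → Seg c d → Seg a d
  end a   ⧺ t = a ∷ t
  (a ∷ s) ⧺ t = a ∷ (s ⧺ t)

  rev : Seg a b → Seg b a
  rev (end a) = end a
  rev (a ∷ s) = rev s ⧺ end a

  cnt : VSet n → Seg {n} a b → ℕ
  cnt f (end a) = [ f a ]?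
  cnt f (a ∷ s) = [ f a ]? + cnt f s

  cnt-⧺ : (f : VSet n) (s : Seg {n} a b) (t : Seg {n} c d) → cnt f (s ⧺ t) ≡ cnt f s + cnt f t
  cnt-⧺ f (end a) t = refl
  cnt-⧺ f (a ∷ s) t rewrite cnt-⧺ f s t = sym (+-assoc [ f a ]? _ _)

  cnt-rev : (f : VSet n) (s : Seg {n} a b) → cnt f (rev s) ≡ cnt f s
  cnt-rev f (end a) = refl
  cnt-rev f (a ∷ s) rewrite cnt-⧺ f (rev s) (end a) | cnt-rev f s = +-comm (cnt f s) _

  cnt-last : (f : VSet n) (s : Seg {n} a b) → f b ≡ true → 0 < cnt f s
  cnt-last f (end a) e rewrite e = s≤s z≤n
  cnt-last f (a ∷ s) e = ≤-trans (cnt-last f s e) (m≤n+m _ [ f a ]?)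

  cnt-first : (f : VSet n) (s : Seg {n} a b) → f a ≡ true → 0 < cnt f s
  cnt-first f s e = subst (0 <_) (cnt-rev f s) (cnt-last f (rev s) e)

  bad : Graph n → Seg {n} a b → ℕ
  bad G (end a)       = 0
  bad G (_∷_ a {b} s) = [ not (adj G a b) ]? + bad G s

  bad-⧺ : ∀ (G : Graph n) (s : Seg {n} a b) (t : Seg {n} c d) →
    bad G (s ⧺ t) ≡ bad G s + ([ not (adj G b c) ]? + bad G t)
  bad-⧺ G (end a) t = refl
  bad-⧺ {b = b} {c = c} G (_∷_ a {a′} (end .a′)) t rewrite +-identityʳ [ not (adj G a a′) ]? = refl
  bad-⧺ {b = b} {c = c} G (_∷_ a {a′} s@(_ ∷ _)) t rewrite bad-⧺ G s t =
    sym (+-assoc [ not (adj G a a′) ]? _ _)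

  bad-rev : (G : Graph n) (s : Seg {n} a b) → bad G (rev s) ≡ bad G s
  bad-rev G (end a) = refl
  bad-rev G (_∷_ a {a′} s) rewrite bad-⧺ G (rev s) (end a) | bad-rev G s | Graph.sym G a a′
    | +-identityʳ [ not (adj G a′ a) ]? = +-comm (bad G s) _

  record Split {n} (f g : VSet n) {a b : Fin n} (s : Seg {n} a b) : Set where
    constructor split
    field
      {p q} : Fin n
      left  : Seg a p
      right : Seg q b
      f-p   : f p ≡ true
      g-q   : g q ≡ true
      glue  : s ≡ left ⧺ right

  -- Without a consecutive pair `p`, `q` with `f p` and `g q`, each of the |s| - 1 consecutive pairs
  -- contributes at most one to the sum of `f p` and `g q`. That sum misses only `f` at the last and
  -- `g` at the first vertex, which are the two correction terms.
  scan : ∀ (f g : VSet n) (s : Seg {n} a b) →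
    Split f g s ⊎ (cnt f s + cnt g s + 1 ≤ cnt (λ _ → true) s + [ f b ]? + [ g a ]?)
  scan f g (end a) = inj₂ (≤-reflexive (shift [ f a ]? [ g a ]?))
    where
    shift : ∀ x y → x + y + 1 ≡ 1 + x + y
    shift = solve-∀
  scan f g (_∷_ a {b} {c} s) with bool-cases (f a ∧ g b)
  ... | inj₁ e with ∧-true⁻ {f a} e
  ...   | fa , gb = inj₁ (split (end a) s fa gb refl)
  scan f g (_∷_ a {b} {c} s) | inj₂ e with scan f g s
  ...   | inj₁ (split l r fp gq refl) = inj₁ (split (a ∷ l) r fp gq refl)
  ...   | inj₂ h = inj₂ (linear 1 (+-mono-≤ h (atMostOne (f a) (g b) e))
            (cert [ f a ]? [ g a ]? [ f c ]? [ g b ]? (cnt f s) (cnt g s) (cnt (λ _ → true) s)))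
    where
    atMostOne : ∀ x y → x ∧ y ≡ false → [ x ]? + [ y ]? ≤ 1
    atMostOne true  false _ = ≤-refl
    atMostOne false y     _ = []?≤1 y
    cert : ∀ fa ga fc gb F H T → (1 + T + fc + ga) * 1 + (F + H + 1 + (fa + gb))
      ≡ (fa + F + (ga + H) + 1) * 1 + (T + fc + gb + 1) + 0
    cert = solve-∀

  record BadPair {n} (G : Graph n) {a b : Fin n} (s : Seg {n} a b) : Set where
    constructor badPair
    field
      {p q} : Fin n
      left  : Seg a p
      right : Seg q b
      ¬adj  : adj G p q ≡ false
      glue  : s ≡ left ⧺ right

  findBad : ∀ (G : Graph n) (s : Seg {n} a b) → BadPair G s ⊎ (bad G s ≡ 0)
  findBad G (end a) = inj₂ refl
  findBad G (_∷_ a {b} s) with adj G a b in eq | findBad G s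
  ... | false | _ = inj₁ (badPair (end a) s eq refl)
  ... | true  | inj₁ (badPair l r ¬e refl) = inj₁ (badPair (a ∷ l) r ¬e refl)
  ... | true  | inj₂ h = inj₂ h

  -- Taking singletons for `f` shows that each vertex of `X` occurs exactly once and no other vertex
  -- occurs. In this form reversal and concatenation preserve it by identities between counts,
  -- without permutations.
  Spans : VSet n → Seg {n} a b → Set
  Spans X s = ∀ f → cnt f s ≡ count (X ∩ f)

  -- Tested on the complement of `X`, `Spans` gives count zero. This puts both vertices of a bad
  -- pair into `X`, where the degree condition applies to them.
  spans-last : ∀ {X : VSet n} {s : Seg {n} a b} (l : Seg {n} a c) (r : Seg {n} d b) → s ≡ l ⧺ r → Spans X s →
    (X c ≡ true) × (X d ≡ true)
  spans-last {n} {c = c} {d = d} {X} l r refl spans = inX c (λ e → left (cnt-last _ l (not-true⁺ e))) , inX d (λ e → right (cnt-first _ r (not-true⁺ e)))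
    where
    outside : cnt (compl X) l + cnt (compl X) r ≡ 0
    outside = trans (sym (cnt-⧺ (compl X) l r)) (trans (spans (compl X))
      (trans (count-cong (X ∩ compl X) (λ _ → false) (λ v → contra (X v))) (trans (sum-const {n} 0) (*-zeroʳ n))))
      where
      contra : ∀ x → x ∧ not x ≡ false
      contra true  = refl
      contra false = refl
    left : 0 < cnt (compl X) l → ⊥
    left h = <⇒≢ h (sym (m+n≡0⇒m≡0 _ outside))
    right : 0 < cnt (compl X) r → ⊥
    right h = <⇒≢ h (sym (m+n≡0⇒n≡0 (cnt (compl X) l) outside))
    inX : ∀ v → (X v ≡ false → ⊥) → X v ≡ true
    inX v h with bool-cases (X v)
    ... | inj₁ e = e
    ... | inj₂ e = ⊥-elim (h e)

  -- Pairs inside the reversed stretch stay adjacent or not as before, by symmetry. Only the two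
  -- junctions change: both new ones are edges, and at least one old one was not.
  reverse-middle : ∀ (G : Graph n) {x y y′ z} (l : Seg {n} a x) (s : Seg {n} y y′) (r : Seg {n} z b) →
    adj G x y′ ≡ true → adj G y z ≡ true → (adj G x y ≡ false) ⊎ (adj G y′ z ≡ false) →
    bad G (l ⧺ (rev s ⧺ r)) < bad G (l ⧺ (s ⧺ r))
  reverse-middle G {x} {y} {y′} {z} l s r new₁ new₂ old
    rewrite bad-⧺ G l (rev s ⧺ r) | bad-⧺ G l (s ⧺ r) | bad-⧺ G (rev s) r | bad-⧺ G s r
          | bad-rev G s | new₁ | new₂ =
    linear 1 (oneBad old) (cert [ not (adj G x y) ]? [ not (adj G y′ z) ]? (bad G l) (bad G s) (bad G r))
    where
    oneBad : (adj G x y ≡ false) ⊎ (adj G y′ z ≡ false) →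
      1 ≤ [ not (adj G x y) ]? + [ not (adj G y′ z) ]?
    oneBad (inj₁ e) rewrite e = s≤s z≤n
    oneBad (inj₂ e) rewrite e = m≤n+m 1 _
    cert : ∀ u v L S R → (L + (u + (S + (v + R)))) * 1 + 1 ≡ suc (L + (S + R)) * 1 + (u + v) + 0
    cert = solve-∀

  cnt-reverse-middle : ∀ (f : VSet n) {x y y′ z} (l : Seg {n} a x) (s : Seg {n} y y′) (r : Seg {n} z b) →
    cnt f (l ⧺ (rev s ⧺ r)) ≡ cnt f (l ⧺ (s ⧺ r))
  cnt-reverse-middle f l s r rewrite cnt-⧺ f l (rev s ⧺ r) | cnt-⧺ f l (s ⧺ r)
    | cnt-⧺ f (rev s) r | cnt-⧺ f s r | cnt-rev f s = refl

  ⧺-assoc : ∀ {x y} (s : Seg a b) (t : Seg c d) (u : Seg {n} x y) → (s ⧺ t) ⧺ u ≡ s ⧺ (t ⧺ u)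
  ⧺-assoc (end a) t u = refl
  ⧺-assoc (a ∷ s) t u = cong (a ∷_) (⧺-assoc s t u)

  -- A minimum-degree form of Ore's condition: two such vertices have degree sum at least |X| + 1,
  -- the threshold for Hamilton-connectedness.
  OreDense : Graph n → VSet n → Set
  OreDense G X = ∀ v → X v ≡ true → count X + 1 ≤ 2 * degIn G v X

  -- A bad pair u v of the sequence is repaired by reversing the stretch between it and
  -- a consecutive pair p q with u ~ p and v ~ q; if there were none, deg u + deg v ≤ |X|.
  improve : ∀ (G : Graph n) {X} → OreDense G X → (s : Seg {n} a b) → Spans X s → BadPair G s →
    Σ (Seg a b) λ s′ → Spans X s′ × bad G s′ < bad G s
  improve {n} {a = a} {b = b} G {X} dense s spans (badPair {u} {v} l r u≁v refl)
    with scan (adj G u) (adj G v) l | scan (adj G u) (adj G v) r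
  ... | inj₁ (split {p} {q} l₁ l₂ u~p v~q refl) | _ rewrite ⧺-assoc l₁ l₂ r =
    l₁ ⧺ (rev l₂ ⧺ r) , (λ f → trans (cnt-reverse-middle f l₁ l₂ r) (spans f)) ,
    reverse-middle G l₁ l₂ r (trans (Graph.sym G p u) u~p) (trans (Graph.sym G q v) v~q) (inj₂ u≁v)
  ... | inj₂ _ | inj₁ (split r₁ r₂ u~p v~q refl) =
    l ⧺ (rev r₁ ⧺ r₂) , (λ f → trans (cnt-reverse-middle f l r₁ r₂) (spans f)) ,
    reverse-middle G l r₁ r₂ u~p v~q (inj₁ u≁v)
  ... | inj₂ h₁ | inj₂ h₂ = ⊥-elim (<⇒≱ {count X} {count X} total ≤-refl)
    where
    uvX = spans-last l r refl spans
    all≡ : cnt (λ _ → true) l + cnt (λ _ → true) r ≡ count X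
    all≡ = trans (sym (cnt-⧺ _ l r)) (trans (spans _) (count-cong (X ∩ (λ _ → true)) X (λ i → ∧-comm (X i) true)))
    deg≡ : ∀ w → degIn G w X ≡ cnt (adj G w) l + cnt (adj G w) r
    deg≡ w = trans (sym (spans (adj G w))) (cnt-⧺ (adj G w) l r)
    total : count X < count X
    total with dense u (proj₁ uvX) | dense v (proj₂ uvX)
    -- The correction terms of `scan` at `u` and `v` vanish because no vertex is its own neighbour.
    -- Those at the ends `a` and `b` amount to at most 2, which the `+ 1` of each of the two scans
    -- absorbs.
    ... | du | dv rewrite deg≡ u | deg≡ v | sym all≡ | irrefl G u | irrefl G v =
      linear 2 (+-mono-≤ (+-mono-≤ (*-monoʳ-≤ 2 (+-mono-≤ h₁ h₂)) (*-monoʳ-≤ 2 (+-mono-≤ ([]?≤1 (adj G u b)) ([]?≤1 (adj G v a))))) (+-mono-≤ du dv))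
        (cert (cnt (adj G u) l) (cnt (adj G u) r) (cnt (adj G v) l) (cnt (adj G v) r)
              (cnt (λ _ → true) l) (cnt (λ _ → true) r) [ adj G u b ]? [ adj G v a ]?)
      where
      cert : ∀ ul ur vl vr L R x y →
        (L + R) * 2 + (2 * ((ul + vl + 1) + (ur + vr + 1)) + 2 * (x + y) + ((L + R + 1) + (L + R + 1)))
        ≡ suc (L + R) * 2 + (2 * ((L + 0 + y) + (R + x + 0)) + 2 * (1 + 1) + (2 * (ul + ur) + 2 * (vl + vr))) + 0
      cert = solve-∀

  hamiltonian : ∀ (G : Graph n) {X} → OreDense G X → ∀ k (s : Seg {n} a b) → Spans X s → bad G s ≤ k →
    Σ (Seg a b) λ s′ → Spans X s′ × bad G s′ ≡ 0
  hamiltonian G dense k s spans h with findBad G s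
  ... | inj₂ e = s , spans , e
  hamiltonian G dense zero s spans h | inj₁ bp = s , spans , n≤0⇒n≡0 h
  hamiltonian G dense (suc k) s spans h | inj₁ bp with improve G dense s spans bp
  ... | s′ , spans′ , lt = hamiltonian G dense k s′ spans′ (s≤s⁻¹ (≤-trans lt h))

  cntL : VSet n → List (Fin n) → ℕ
  cntL f []       = 0
  cntL f (x ∷ xs) = [ f x ]? + cntL f xs

  elements : VSet n → List (Fin n)
  elements {zero}  p = []
  elements {suc n} p = if p zero then zero ∷ rest else rest
    where rest = List.map suc (elements (λ i → p (suc i)))

  cntL-map-suc : (f : VSet (suc n)) (xs : List (Fin n)) →
    cntL f (List.map suc xs) ≡ cntL (λ i → f (suc i)) xs
  cntL-map-suc f []       = refl
  cntL-map-suc f (x ∷ xs) = cong ([ f (suc x) ]? +_) (cntL-map-suc f xs)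

  cntL-elements : (p f : VSet n) → cntL f (elements p) ≡ count (p ∩ f)
  cntL-elements {zero}  p f = refl
  cntL-elements {suc n} p f with p zero
  ... | true  = cong ([ f zero ]? +_) (trans (cntL-map-suc f (elements (λ i → p (suc i)))) (cntL-elements (λ i → p (suc i)) (λ i → f (suc i))))
  ... | false = trans (cntL-map-suc f (elements (λ i → p (suc i)))) (cntL-elements (λ i → p (suc i)) (λ i → f (suc i)))

  length≡cntL : (xs : List (Fin n)) → length xs ≡ cntL (λ _ → true) xs
  length≡cntL []       = refl
  length≡cntL (x ∷ xs) = cong suc (length≡cntL xs)

  length-elements : (p : VSet n) → length (elements p) ≡ count p
  length-elements p = trans (length≡cntL (elements p)) (trans (cntL-elements p _)
    (count-cong (p ∩ (λ _ → true)) p (λ i → ∧-comm (p i) true)))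

  cntL>0 : (f : VSet n) (xs : List (Fin n)) → 0 < cntL f xs → ∃ λ v → (v ∈ xs) × (f v ≡ true)
  cntL>0 f (x ∷ xs) h with bool-cases (f x)
  ... | inj₁ e = x , here refl , e
  ... | inj₂ e rewrite e with cntL>0 f xs h
  ...   | v , v∈ , fv = v , there v∈ , fv

  ∈⇒cntL>0 : (f : VSet n) {v : Fin n} {xs : List (Fin n)} → v ∈ xs → f v ≡ true → 0 < cntL f xs
  ∈⇒cntL>0 f (here refl) e rewrite e = s≤s z≤n
  ∈⇒cntL>0 f {xs = x ∷ _} (there v∈) e = ≤-trans (∈⇒cntL>0 f v∈ e) (m≤n+m _ [ f x ]?)

  cntL≤1⇒unique : (xs : List (Fin n)) → (∀ v → cntL (v ==_) xs ≤ 1) → Unique xs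
  cntL≤1⇒unique []       h = []
  cntL≤1⇒unique (x ∷ xs) h = All.tabulate fresh ∷ cntL≤1⇒unique xs (λ v → ≤-trans (m≤n+m _ [ v == x ]?) (h v))
    where
    fresh : ∀ {y} → y ∈ xs → x ≢ y
    fresh {y} y∈ refl with h y
    ... | le rewrite ==-refl y = <⇒≱ (∈⇒cntL>0 (y ==_) y∈ (==-refl y)) (s≤s⁻¹ le)

  spine : (a : Fin n) → List (Fin n) → (b : Fin n) → Seg a b
  spine a []       b = a ∷ end b
  spine a (x ∷ xs) b = a ∷ spine x xs b

  cnt-spine : (f : VSet n) (a b : Fin n) (xs : List (Fin n)) →
    cnt f (spine a xs b) ≡ [ f a ]? + ([ f b ]? + cntL f xs)
  cnt-spine f a b []       = cong ([ f a ]? +_) (sym (+-identityʳ _))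
  cnt-spine f a b (x ∷ xs) = cong ([ f a ]? +_) (trans (cnt-spine f x b xs) (swap [ f x ]? [ f b ]? _))
    where
    swap : ∀ x y z → x + (y + z) ≡ y + (x + z)
    swap = solve-∀

  count-remove : (X f : VSet n) (v : Fin n) → X v ≡ true → count (X ∩ f) ≡ [ f v ]? + count ((X ∖ (v ==_)) ∩ f)
  count-remove X f v Xv = trans (count-split (X ∩ f) (v ==_)) (cong₂ _+_
    (trans (count-cong _ _ (λ w → ∧-comm (X w ∧ f w) (v == w))) (trans (count-single v (X ∩ f)) (cong (λ x → [ x ∧ f v ]?) Xv)))
    (count-cong _ _ (λ w → reorder (X w) (f w) (not (v == w)))))
    where
    reorder : ∀ x y z → (x ∧ y) ∧ z ≡ (x ∧ z) ∧ y
    reorder true  y z = ∧-comm y z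
    reorder false y z = refl

  -- Any ordering of `X` with the prescribed ends can serve as the start, since repairs change only
  -- the interior.
  hamiltonian-connected : ∀ (G : Graph n) (X : VSet n) → OreDense G X → ∀ (a b : Fin n) → a ≢ b →
    X a ≡ true → X b ≡ true → Σ (Seg a b) λ s → Spans X s × bad G s ≡ 0
  hamiltonian-connected G X dense a b a≢b Xa Xb = hamiltonian G dense _ start spans ≤-refl
    where
    Y = (X ∖ (a ==_)) ∖ (b ==_)
    start = spine a (elements Y) b
    spans : Spans X start
    spans f = trans (cnt-spine f a b (elements Y)) (sym (trans (count-remove X f a Xa)
      (cong ([ f a ]? +_) (trans (count-remove (X ∖ (a ==_)) f b (∧-true⁺ Xb (not-true⁺ (≢⇒== a≢b))))
        (cong ([ f b ]? +_) (sym (cntL-elements Y f)))))))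

  toList : {a b : Fin n} → Seg a b → List (Fin n)
  toList (end a) = a ∷ []
  toList (a ∷ s) = a ∷ toList s

  cntL-toList : (f : VSet n) {a b : Fin n} (s : Seg a b) → cntL f (toList s) ≡ cnt f s
  cntL-toList f (end a) = +-identityʳ _
  cntL-toList f (a ∷ s) = cong ([ f a ]? +_) (cntL-toList f s)

  path-∷ : ∀ (G : Graph n) {a b c} (s : Seg {n} b c) {xs} → adj G a b ≡ true →
    PathAdj G (toList s ++ xs) → PathAdj G (a ∷ toList s ++ xs)
  path-∷ G (end b) e h = e , h
  path-∷ G (b ∷ s) e h = e , h

  path-toList : ∀ (G : Graph n) {a b} (s : Seg {n} a b) → bad G s ≡ 0 → ∀ c → adj G b c ≡ true →
    PathAdj G (toList s ++ (c ∷ []))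
  path-toList G (end a) _ c e = e , _
  path-toList G (_∷_ a {b} s) h c e with adj G a b in eq
  ... | true = path-∷ G s eq (path-toList G s h c e)

  spanning-cycle : ∀ (G : Graph n) {a b} (X : VSet n) (s : Seg a b) → Spans X s → bad G s ≡ 0 →
    adj G b a ≡ true → 3 ≤ count X →
    IsCycle G (toList s) × (∀ v → v ∈ toList s → X v ≡ true) × (∀ v → X v ≡ true → v ∈ toList s)
  spanning-cycle {n} G {a} {b} X s spans good e 3≤ = cycle s refl , ∈⇒X , X⇒∈
    where
    cntL≡ : ∀ f → cntL f (toList s) ≡ count (X ∩ f)
    cntL≡ f = trans (cntL-toList f s) (spans f)
    mult : ∀ v → cntL (v ==_) (toList s) ≡ [ X v ]?
    mult v = trans (cntL≡ (v ==_)) (trans (count-cong _ _ (λ w → ∧-comm (X w) (v == w))) (count-single v X))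
    ∈⇒X : ∀ v → v ∈ toList s → X v ≡ true
    ∈⇒X v v∈ with X v | mult v | ∈⇒cntL>0 (v ==_) v∈ (==-refl v)
    ... | true  | _ | _ = refl
    ... | false | m | h = ⊥-elim (<⇒≢ h (sym m))
    X⇒∈ : ∀ v → X v ≡ true → v ∈ toList s
    X⇒∈ v Xv with cntL>0 (v ==_) (toList s) (≤-reflexive (sym (trans (mult v) (cong [_]? Xv))))
    ... | w , w∈ , e = subst (_∈ toList s) (sym (==⇒≡ {x = v} e)) w∈
    len : 3 ≤ length (toList s)
    len = ≤-trans 3≤ (≤-reflexive (sym (trans (length≡cntL (toList s)) (trans (cntL≡ _)
      (count-cong _ _ (λ i → ∧-comm (X i) true))))))
    uniq : Unique (toList s)
    uniq = cntL≤1⇒unique (toList s) (λ v → ≤-trans (≤-reflexive (mult v)) ([]?≤1 (X v)))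
    -- `IsCycle` unfolds only when the head of the list is visible. Matching on a copy of `s` shows
    -- that the head is `a` in either case.
    cycle : (t : Seg a b) → t ≡ s → IsCycle G (toList t)
    cycle (end .a) refl = len , uniq , path-toList G s good a e
    cycle (.a ∷ t) refl = len , uniq , path-toList G s good a e

  -- Trees given by parent functions

  snocWalk : ∀ {G : Graph n} {W u v w} → Walk G W u v → adj G v w ≡ true → W w ≡ true → Walk G W u w
  snocWalk (here Wu)      e Ww = step Wu e (here Ww)
  snocWalk (step Wu a uv) e Ww = step Wu a (snocWalk uv e Ww)

  _▷_ : ∀ {G : Graph n} {W u v w} → Walk G W u v → Walk G W v w → Walk G W u w
  here _ ▷ vw       = vw
  step Wu a uv ▷ vw = step Wu a (uv ▷ vw)

  unique-≤-count : ∀ (p : VSet n) {xs} → Unique xs → All (λ x → p x ≡ true) xs → length xs ≤ count p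
  unique-≤-count p [] [] = z≤n
  unique-≤-count p {x ∷ xs} (x∉ ∷ u) (px ∷ pxs) = subst (suc (length xs) ≤_) (sym split-off)
    (s≤s (unique-≤-count (p ∖ (x ==_)) u (All.zipWith (λ (x≢y , py) → ∧-true⁺ py (not-true⁺ (≢⇒== x≢y))) (x∉ , pxs))))
    where
    split-off : count p ≡ suc (count (p ∖ (x ==_)))
    split-off = trans (count-cong _ _ (λ i → sym (∧-identityʳ (p i)))) (trans (count-remove p (λ _ → true) x px)
      (cong suc (count-cong _ _ (λ i → ∧-identityʳ ((p ∖ (x ==_)) i)))))

  -- `rank` need not be the distance to the root: a strict fall along parents suffices for induction
  -- towards `ρ` and for excluding cycles. Three children, rather than three neighbours, also settle
  -- the degree of the root, which has no parent.
  module ParentTree {n} (G : Graph n) (S : VSet n) (ρ : Fin n) (ρ∈S : S ρ ≡ true)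
    (p : Fin n → Fin n) (rank : Fin n → ℕ)
    (p-adj : ∀ v → v ≢ ρ → adj G v (p v) ≡ true)
    (p-rank : ∀ v → v ≢ ρ → rank (p v) < rank v)
    (p∈S : ∀ v → v ≢ ρ → S (p v) ≡ true)
    (children : ∀ s → S s ≡ true → ∃ λ xs → (length xs ≡ 3) × Unique xs × All (λ x → (x ≢ ρ) × (p x ≡ s)) xs)
    where

    Child : Fin n → Fin n → Set
    Child u v = (u ≢ ρ) × (p u ≡ v)

    child : Fin n → Fin n → Bool
    child u v = not (u == ρ) ∧ (p u == v)

    child⁻ : ∀ {u v} → child u v ≡ true → Child u v
    child⁻ {u} e with ∧-true⁻ {not (u == ρ)} e
    ... | h , k = ==-false⇒≢ (not-true⁻ h) , ==⇒≡ k

    child⁺ : ∀ {u v} → Child u v → child u v ≡ true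
    child⁺ {u} (h , refl) = ∧-true⁺ (not-true⁺ (≢⇒== h)) (==-refl (p u))

    child-rank : ∀ {u v} → Child u v → rank v < rank u
    child-rank (h , refl) = p-rank _ h

    T : Graph n
    T = record
      { adj    = λ u v → child u v ∨ child v u
      ; sym    = λ u v → ∨-comm (child u v) (child v u)
      ; irrefl = loopless
      }
      where
      loopless : ∀ v → child v v ∨ child v v ≡ false
      loopless v with bool-cases (child v v)
      ... | inj₁ e = ⊥-elim (<-irrefl refl (child-rank (child⁻ {v} e)))
      ... | inj₂ e rewrite e = refl

    edge⁻ : ∀ u v → adj T u v ≡ true → Child u v ⊎ Child v u
    edge⁻ u v e with ∨-true⁻ {child u v} e
    ... | inj₁ h = inj₁ (child⁻ h)
    ... | inj₂ h = inj₂ (child⁻ h)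

    subgraph : Subgraph T G
    subgraph u v e with edge⁻ u v e
    ... | inj₁ (h , refl) = p-adj u h
    ... | inj₂ (h , refl) = trans (Graph.sym G u v) (p-adj v h)

    toRoot : ∀ k v → rank v ≤ k → Walk T (λ _ → true) v ρ × Walk T (λ _ → true) ρ v
    toRoot k v h with v Fin.≟ ρ
    ... | yes refl = here refl , here refl
    toRoot zero v h | no v≢ρ = ⊥-elim (<⇒≱ (p-rank v v≢ρ) (≤-trans h z≤n))
    toRoot (suc k) v h | no v≢ρ with toRoot k (p v) (s≤s⁻¹ (≤-trans (p-rank v v≢ρ) h)) | child⁺ {v} (v≢ρ , refl)
    ... | up , down | e = step refl (∨-true⁺ˡ e) up , snocWalk down (∨-true⁺ʳ {child (p v) v} e) refl

    connected : Connected T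
    connected u v _ _ = proj₁ (toRoot _ u ≤-refl) ▷ proj₂ (toRoot _ v ≤-refl)

    NonBacktracking : List (Fin n) → Set
    NonBacktracking (x ∷ zs@(y ∷ z ∷ _)) = (x ≢ z) × NonBacktracking zs
    NonBacktracking _ = ⊤

    nonBacktracking-tail : ∀ x ys → NonBacktracking (x ∷ ys) → NonBacktracking ys
    nonBacktracking-tail x []          _  = _
    nonBacktracking-tail x (_ ∷ [])    _  = _
    nonBacktracking-tail x (_ ∷ _ ∷ _) nb = proj₂ nb

    lastOf : Fin n → List (Fin n) → Fin n
    lastOf x []       = x
    lastOf x (y ∷ ys) = lastOf y ys

    lastOf∈ : ∀ y ys → lastOf y ys ∈ y ∷ ys
    lastOf∈ y []       = here refl
    lastOf∈ y (z ∷ zs) = there (lastOf∈ z zs)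

    nonBacktracking : ∀ ys e → Unique ys → All (_≢ e) ys → NonBacktracking (ys ++ (e ∷ []))
    nonBacktracking []               e _ _ = _
    nonBacktracking (x ∷ [])         e _ _ = _
    nonBacktracking (x ∷ y ∷ [])     e _ (x≢e ∷ _) = x≢e , _
    nonBacktracking (x ∷ y ∷ z ∷ zs) e ((_ ∷ x≢z ∷ _) ∷ u) (_ ∷ a) = x≢z , nonBacktracking (y ∷ z ∷ zs) e u a

    -- A non-backtracking walk that has once moved away from the root can only move further away.
    descend : ∀ x y ys e → Child y x → NonBacktracking (x ∷ y ∷ ys ++ (e ∷ [])) → PathAdj T (y ∷ ys ++ (e ∷ [])) →
      Child e (lastOf y ys) × rank y < rank e
    descend x y [] e (_ , py≡x) (x≢e , _) (ye , _) with edge⁻ y e ye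
    ... | inj₁ (_ , py≡e) = ⊥-elim (x≢e (trans (sym py≡x) py≡e))
    ... | inj₂ c = c , child-rank c
    descend x y (z ∷ zs) e (_ , py≡x) (x≢z , nb) (yz , path) with edge⁻ y z yz
    ... | inj₁ (_ , py≡z) = ⊥-elim (x≢z (trans (sym py≡x) py≡z))
    ... | inj₂ c with descend y z zs e c nb path
    ...   | c′ , lt = c′ , <-trans (child-rank c) lt

    -- Either every step goes to a parent and the rank falls throughout, or some step goes to a
    -- child and from there `descend` governs the rest of the walk.
    descends-at-end : ∀ x ys e → NonBacktracking (x ∷ ys ++ (e ∷ [])) → PathAdj T (x ∷ ys ++ (e ∷ [])) →
      (rank e < rank x) ⊎ Child e (lastOf x ys)
    descends-at-end x [] e _ (xe , _) with edge⁻ x e xe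
    ... | inj₁ c = inj₁ (child-rank c)
    ... | inj₂ c = inj₂ c
    descends-at-end x (y ∷ ys) e nb (xy , path) with edge⁻ x y xy
    ... | inj₂ c = inj₂ (proj₁ (descend x y ys e c nb path))
    ... | inj₁ c with descends-at-end y ys e (nonBacktracking-tail x (y ∷ ys ++ (e ∷ [])) nb) path
    ...   | inj₁ lt = inj₁ (<-trans lt (child-rank c))
    ...   | inj₂ c′ = inj₂ c′

    acyclic : ∀ vs → ¬ IsCycle T vs
    acyclic (v ∷ [])     (s≤s () , _)
    acyclic (v ∷ _ ∷ []) (s≤s (s≤s ()) , _)
    -- Read the cycle as a walk from `v` back to `v`. It cannot climb throughout, so it returns from
    -- the parent of `v`. If its first step is upwards, that parent is both the second and the last
    -- vertex; if downwards, the rank of `v` exceeds that of its child `x`.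
    acyclic (v ∷ x ∷ y ∷ ys) (_ , (v≢x ∷ v≢y ∷ v≢ys) ∷ uniq@(x≢ ∷ _) , path@(vx , path′))
      = contradiction (descends-at-end v (x ∷ y ∷ ys) v nb path) (edge⁻ v x vx)
      where
      nb : NonBacktracking (v ∷ x ∷ y ∷ ys ++ (v ∷ []))
      nb = v≢y , nonBacktracking (x ∷ y ∷ ys) v uniq (All.map (λ h → h ∘ sym) (v≢x ∷ v≢y ∷ v≢ys))
      contradiction : (rank v < rank v) ⊎ Child v (lastOf y ys) → Child v x ⊎ Child x v → ⊥
      contradiction (inj₁ lt) _ = <-irrefl refl lt
      contradiction (inj₂ (_ , e)) (inj₁ (_ , e′)) = All.lookup x≢ (lastOf∈ y ys) (trans (sym e′) e)
      contradiction (inj₂ _) (inj₂ c) =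
        <-asym (child-rank c) (proj₂ (descend v x (y ∷ ys) v c nb path′))

    leaf-degree : ∀ v → S v ≡ false → degree T v ≡ 1
    leaf-degree v v∉S = trans (count-cong _ _ onlyParent) (count-single (p v) (λ _ → true))
      where
      v≢ρ : v ≢ ρ
      v≢ρ refl = true≢false ρ∈S v∉S
      onlyParent : ∀ w → adj T v w ≡ (p v == w) ∧ true
      onlyParent w with bool-cases (child w v)
      ... | inj₁ e with child⁻ {w} e
      ...   | w≢ρ , refl = ⊥-elim (true≢false (p∈S w w≢ρ) v∉S)
      onlyParent w | inj₂ e rewrite e | ≢⇒== v≢ρ | ∨-identityʳ (p v == w) | ∧-identityʳ (p v == w) = refl

    internal-degree : ∀ v → S v ≡ true → 3 ≤ degree T v
    internal-degree v v∈S with children v v∈S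
    ... | xs , len , uniq , ch = subst (_≤ degree T v) len
      (unique-≤-count (adj T v) uniq (All.map (λ {x} c → ∨-true⁺ʳ {child v x} (child⁺ c)) ch))

    hist : IsHIST G T
    hist = subgraph , (connected , acyclic) , no-degree-2
      where
      no-degree-2 : ∀ v → degree T v ≢ 2
      no-degree-2 v e with bool-cases (S v)
      ... | inj₁ v∈S = <⇒≢ (internal-degree v v∈S) (sym e)
      ... | inj₂ v∉S with trans (sym (leaf-degree v v∉S)) e
      ...   | ()

    leaf⇒∉S : ∀ v → IsLeaf T v → S v ≡ false
    leaf⇒∉S v e with bool-cases (S v)
    ... | inj₂ v∉S = v∉S
    ... | inj₁ v∈S = ⊥-elim (<⇒≢ (≤-trans (s≤s (s≤s z≤n)) (internal-degree v v∈S)) (sym e))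

  -- Homeomorphically irreducible spanning trees

  -- The rank acts as a time of insertion: since it stays below `length S`, a newcomer can take
  -- `length S` itself and lie above everything present.
  record Rooted {n} (G : Graph n) (ρ : Fin n) (S : List (Fin n)) : Set where
    field
      parent : Fin n → Fin n
      rank   : Fin n → ℕ
      root∈  : mem S ρ ≡ true
      valid  : ∀ v → mem S v ≡ true → v ≢ ρ →
        (adj G v (parent v) ≡ true) × (mem S (parent v) ≡ true) × (rank (parent v) < rank v)
      rank<  : ∀ v → mem S v ≡ true → rank v < length S

  rooted-singleton : (G : Graph n) (ρ : Fin n) → Rooted G ρ (ρ ∷ [])
  rooted-singleton G ρ = record
    { parent = λ v → v
    ; rank   = λ _ → 0
    ; root∈  = mem-head ρ []
    ; valid  = λ v v∈ v≢ρ → ⊥-elim (true≢false v∈ (∉-∷⁺ ρ [] v≢ρ refl))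
    ; rank<  = λ _ _ → s≤s z≤n
    }

  rooted-∷ : ∀ {G : Graph n} {ρ S} → Rooted G ρ S → ∀ u v → mem S u ≡ true → mem S v ≡ false →
    adj G v u ≡ true → Rooted G ρ (v ∷ S)
  rooted-∷ {n} {G} {ρ} {S} R u v u∈ v∉ vu = record
    { parent = parent′
    ; rank   = rank′
    ; root∈  = mem-∷ v S root∈
    ; valid  = valid′
    ; rank<  = rank<′
    }
    where
    open Rooted R
    parent′ : Fin n → Fin n
    parent′ w = if v == w then u else parent w
    rank′ : Fin n → ℕ
    rank′ w = if v == w then length S else rank w
    v≢ : ∀ w → mem S w ≡ true → v ≢ w
    v≢ w w∈ refl = true≢false w∈ v∉
    rank-old : ∀ w → mem S w ≡ true → rank′ w ≡ rank w
    rank-old w w∈ rewrite ≢⇒== (v≢ w w∈) = refl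
    valid′ : ∀ w → mem (v ∷ S) w ≡ true → w ≢ ρ →
      (adj G w (parent′ w) ≡ true) × (mem (v ∷ S) (parent′ w) ≡ true) × (rank′ (parent′ w) < rank′ w)
    valid′ w w∈ w≢ρ with v Fin.≟ w
    ... | yes refl = vu , mem-∷ v S u∈ , subst (_< length S) (sym (rank-old u u∈)) (rank< u u∈)
    ... | no v≢w with valid w (subst (λ b → b ∨ mem S w ≡ true) refl w∈) w≢ρ
    ...   | e , p∈ , lt = e , mem-∷ v S p∈ , subst (_< rank w) (sym (rank-old _ p∈)) lt
    rank<′ : ∀ w → mem (v ∷ S) w ≡ true → rank′ w < length (v ∷ S)
    rank<′ w w∈ with v Fin.≟ w
    ... | yes _ = ≤-refl
    ... | no  _ = m≤n⇒m≤1+n (rank< w w∈)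

  -- Every core vertex seizes three leaves of its own, so that its degree in the tree is at least three.
  record PrivateLeaves {n} (G : Graph n) (S : VSet n) (ss : List (Fin n)) : Set where
    field
      assign : Fin n → Fin n
      valid  : ∀ v → S v ≡ false → (adj G v (assign v) ≡ true) × (S (assign v) ≡ true)
      used   : List (Fin n)
      len    : length used ≡ 3 * length ss
      three  : ∀ s → mem ss s ≡ true → ∃ λ xs → (length xs ≡ 3) × Unique xs ×
        All (λ x → (mem used x ≡ true) × (S x ≡ false) × (assign x ≡ s)) xs

  private-leaves : ∀ (G : Graph n) (S : VSet n) N → (∀ v → S v ≡ false → ∃ λ u → (S u ≡ true) × (adj G v u ≡ true)) →
    ∀ ss → (∀ s → mem ss s ≡ true → (S s ≡ true) × N ≤ degIn G s (compl S)) → 3 * length ss ≤ N →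
    PrivateLeaves G S ss
  private-leaves {n} G S N dom [] _ _ = record
    { assign = assign
    ; valid  = valid
    ; used   = []
    ; len    = refl
    ; three  = λ _ ()
    }
    where
    assign : Fin n → Fin n
    assign v with bool-cases (S v)
    ... | inj₁ _   = v
    ... | inj₂ v∉S = proj₁ (dom v v∉S)
    valid : ∀ v → S v ≡ false → (adj G v (assign v) ≡ true) × (S (assign v) ≡ true)
    valid v v∉S with bool-cases (S v)
    ... | inj₁ v∈S = ⊥-elim (true≢false v∈S v∉S)
    ... | inj₂ h with dom v h
    ...   | u , u∈ , vu = vu , u∈
  private-leaves {n} G S N dom (s ∷ ss) deg 3ss≤N
    with private-leaves G S N dom ss (λ t t∈ → deg t (mem-∷ s ss t∈))
           (≤-trans (*-monoʳ-≤ 3 (n≤1+n (length ss))) 3ss≤N)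
  ... | record { assign = q ; valid = valid ; used = used ; len = len ; three = three }
    with deg s (mem-head s ss)
  ... | s∈S , N≤ = three-more (pick∉ P used (fits 0 z≤n)) 
    where
    P : VSet n
    P = compl S ∩ adj G s
    enough : 3 + length used ≤ count P
    enough rewrite len = ≤-trans (≤-reflexive (sym (*-suc 3 (length ss)))) (≤-trans 3ss≤N N≤)
    fits : ∀ k → k ≤ 2 → suc (k + length used) ≤ count P
    fits k k≤2 = ≤-trans (s≤s (+-monoˡ-≤ (length used) k≤2)) enough
    three-more : (∃ λ v → (P v ≡ true) × (mem used v ≡ false)) → PrivateLeaves G S (s ∷ ss)
    three-more (x , Px , x∉) with pick∉ P (x ∷ used) (fits 1 (s≤s z≤n))
    ... | y , Py , y∉ with pick∉ P (y ∷ x ∷ used) (fits 2 ≤-refl)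
    ...   | z , Pz , z∉ = record
      { assign = q′
      ; valid  = valid′
      ; used   = new ++ used
      ; len    = trans (cong (3 +_) len) (sym (*-suc 3 (length ss)))
      ; three  = three′
      }
      where
      new : List (Fin n)
      new = z ∷ y ∷ x ∷ []
      q′ : Fin n → Fin n
      q′ v = if mem new v then s else q v
      mem-new : ∀ v → mem new v ≡ true → P v ≡ true
      mem-new v v∈ with mem-∷⁻ z (y ∷ x ∷ []) v∈
      ... | inj₁ refl = Pz
      ... | inj₂ v∈′ with mem-∷⁻ y (x ∷ []) v∈′
      ...   | inj₁ refl = Py
      ...   | inj₂ v∈″ with mem-∷⁻ x ([]) v∈″
      ...     | inj₁ refl = Px
      P-valid : ∀ v → P v ≡ true → (adj G v s ≡ true) × (S v ≡ false)
      P-valid v Pv with ∧-true⁻ {compl S v} Pv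
      ... | v∉S , sv = trans (Graph.sym G v s) sv , not-true⁻ v∉S
      valid′ : ∀ v → S v ≡ false → (adj G v (q′ v) ≡ true) × (S (q′ v) ≡ true)
      valid′ v v∉S with bool-cases (mem new v)
      ... | inj₁ e rewrite e = proj₁ (P-valid v (mem-new v e)) , s∈S
      ... | inj₂ e rewrite e = valid v v∉S
      used-old : ∀ v → mem used v ≡ true → mem new v ≡ false
      used-old v v∈ = ∉-∷⁺ z (y ∷ x ∷ []) (≢z (proj₂ (∉-∷⁻ y (x ∷ used) z∉)))
        (∉-∷⁺ y (x ∷ []) (≢y (proj₂ (∉-∷⁻ x used y∉))) (∉-∷⁺ x [] ≢x refl))
        where
        ≢x : v ≢ x
        ≢x refl = true≢false v∈ x∉
        ≢y : mem used y ≡ false → v ≢ y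
        ≢y h refl = true≢false v∈ h
        ≢z : mem (x ∷ used) z ≡ false → v ≢ z
        ≢z h refl = true≢false (mem-∷ x used v∈) h
      mem-++ : ∀ v → mem used v ≡ true → mem (new ++ used) v ≡ true
      mem-++ v v∈ = mem-∷ z (y ∷ x ∷ used) (mem-∷ y (x ∷ used) (mem-∷ x used v∈))
      q-new : ∀ v → mem new v ≡ true → q′ v ≡ s
      q-new v e rewrite e = refl
      three′ : ∀ t → mem (s ∷ ss) t ≡ true → ∃ λ xs → (length xs ≡ 3) × Unique xs ×
        All (λ x → (mem (new ++ used) x ≡ true) × (S x ≡ false) × (q′ x ≡ t)) xs
      three′ t t∈ with s Fin.≟ t
      ... | yes refl = new , refl ,
        ((proj₁ (∉-∷⁻ y (x ∷ used) z∉) ∷ proj₁ (∉-∷⁻ x used (proj₂ (∉-∷⁻ y (x ∷ used) z∉))) ∷ [])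
          ∷ (proj₁ (∉-∷⁻ x used y∉) ∷ []) ∷ [] ∷ []) ,
        (mem-head z (y ∷ x ∷ used) , proj₂ (P-valid z Pz) , q-new z (mem-head z (y ∷ x ∷ []))) ∷
        (mem-∷ z (y ∷ x ∷ used) (mem-head y (x ∷ used)) , proj₂ (P-valid y Py) , q-new y (mem-∷ z (y ∷ x ∷ []) (mem-head y (x ∷ [])))) ∷
        (mem-∷ z (y ∷ x ∷ used) (mem-∷ y (x ∷ used) (mem-head x used)) , proj₂ (P-valid x Px) , q-new x (mem-∷ z (y ∷ x ∷ []) (mem-∷ y (x ∷ []) (mem-head x [])))) ∷ []
      ... | no _ with three t t∈
      ...   | xs , l , u , al = xs , l , u , All.map (λ {v} (v∈ , v∉S , e) → mem-++ v v∈ , v∉S , trans (cong (λ b → if b then s else q v) (used-old v v∈)) e) al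

  hist-with-core : ∀ (G : Graph n) {ρ S} → Rooted G ρ S →
    (∀ v → mem S v ≡ false → ∃ λ u → (mem S u ≡ true) × (adj G v u ≡ true)) →
    (∀ s → mem S s ≡ true → 3 * length S ≤ degIn G s (compl (mem S))) →
    Σ (Graph n) λ T → IsHIST G T × (∀ v → mem S v ≡ false → IsLeaf T v) × (∀ v → IsLeaf T v → mem S v ≡ false)
  hist-with-core {n} G {ρ} {S} R dom deg = T , hist , leaf-degree , leaf⇒∉S
    where
    open Rooted R
    module L = PrivateLeaves (private-leaves G (mem S) (3 * length S) dom S (λ s s∈ → s∈ , deg s s∈) ≤-refl)
    p : Fin n → Fin n
    p v = if mem S v then parent v else L.assign v
    -- All leaves share a rank above that of every core vertex, as parents lie in the core.
    r : Fin n → ℕ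
    r v = if mem S v then rank v else length S
    all : ∀ v → v ≢ ρ → (adj G v (p v) ≡ true) × (r (p v) < r v) × (mem S (p v) ≡ true)
    all v v≢ρ with bool-cases (mem S v)
    ... | inj₁ e rewrite e with valid v e v≢ρ
    ...   | vp , p∈ , lt rewrite p∈ = vp , lt , refl
    all v v≢ρ | inj₂ e rewrite e with L.valid v e
    ...   | vp , p∈ rewrite p∈ = vp , rank< _ p∈ , refl
    p-adj : ∀ v → v ≢ ρ → adj G v (p v) ≡ true
    p-adj v h = proj₁ (all v h)
    p-rank : ∀ v → v ≢ ρ → r (p v) < r v
    p-rank v h = proj₁ (proj₂ (all v h))
    p∈S : ∀ v → v ≢ ρ → mem S (p v) ≡ true
    p∈S v h = proj₂ (proj₂ (all v h))
    children : ∀ s → mem S s ≡ true → ∃ λ xs → (length xs ≡ 3) × Unique xs × All (λ x → (x ≢ ρ) × (p x ≡ s)) xs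
    children s s∈ with L.three s s∈
    ... | xs , len , uniq , al = xs , len , uniq , All.map (λ {x} (_ , x∉ , e) →
      (λ { refl → true≢false root∈ x∉ }) , trans (cong (λ b → if b then parent x else L.assign x) x∉) e) al
    open ParentTree G (mem S) ρ root∈ p r p-adj p-rank p∈S children

  -- Disjoint crossing edges and dominating sets

  module Matching {n} (G : Graph n) (side : VSet n) where

    Cross : Fin n → Fin n → Set
    Cross x y = (side x ≡ true) × (side y ≡ false) × (adj G x y ≡ true)

    crossing : ∀ {W x y} → Walk G W x y → side x ≡ true → side y ≡ false →
      ∃ λ u → ∃ λ v → Cross u v × (W u ≡ true) × (W v ≡ true)
    crossing (here _) sx sy = ⊥-elim (true≢false sx sy)
    crossing (step {u} {v} Wu uv walk) su sy with bool-cases (side v)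
    ... | inj₁ sv = crossing walk sv sy
    ... | inj₂ sv = u , v , (su , sv , uv) , Wu , start walk
      where
      start : ∀ {W x y} → Walk G W x y → W x ≡ true
      start (here e)     = e
      start (step e _ _) = e

    record Three : Set where
      constructor three
      field
        {x₁ x₂ x₃ y₁ y₂ y₃} : Fin n
        e₁ : Cross x₁ y₁
        e₂ : Cross x₂ y₂
        e₃ : Cross x₃ y₃
        x₁≢x₂ : x₁ ≢ x₂
        x₁≢x₃ : x₁ ≢ x₃
        x₂≢x₃ : x₂ ≢ x₃
        y₁≢y₂ : y₁ ≢ y₂
        y₁≢y₃ : y₁ ≢ y₃
        y₂≢y₃ : y₂ ≢ y₃

    -- Two vertices never cover all crossing edges, which is the hypothesis of König's theorem for a
    -- matching of size three. The two may coincide, and `three-edges` gets its first edge that way.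
    Avoiding : Set
    Avoiding = ∀ u w → ∃ λ x → ∃ λ y → Cross x y × (x ≢ u) × (x ≢ w) × (y ≢ u) × (y ≢ w)

    -- After deletion of `u` and `w` the graph is still connected and both sides still have a
    -- vertex, so a walk between these crosses.
    avoiding : KConnected 3 G → 2 < count side → 2 < count (compl side) → Avoiding
    avoiding (_ , conn) 2<x 2<y u w with pick∉ side (u ∷ w ∷ []) 2<x | pick∉ (compl side) (u ∷ w ∷ []) 2<y
    ... | x , sx , x∉ | y , sy , y∉
      with crossing (conn (mem (u ∷ w ∷ [])) (s≤s (count-mem (u ∷ w ∷ []))) x y (not-true⁺ x∉) (not-true⁺ y∉)) sx (not-true⁻ sy)
    ...   | p , q , e , p∉ , q∉ with ∉-∷⁻ u (w ∷ []) (not-true⁻ p∉) | ∉-∷⁻ u (w ∷ []) (not-true⁻ q∉)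
    ...     | p≢u , p∉w | q≢u , q∉w =
      p , q , e , p≢u , proj₁ (∉-∷⁻ w [] p∉w) , q≢u , proj₁ (∉-∷⁻ w [] q∉w)

    -- König's theorem for matchings of size three: x₁y₁ and x₂y₂ are matched, and the edge p y₁
    -- starts an alternating path that either ends at once or is x₂ q after the edge avoiding y₁, x₂.
    augment : Avoiding → ∀ {x₁ y₁ x₂ y₂ p} → Cross x₁ y₁ → Cross x₂ y₂ → x₁ ≢ x₂ → y₁ ≢ y₂ →
      Cross p y₁ → p ≢ x₁ → p ≢ x₂ → Three
    augment avoid {x₁} {y₁} {x₂} {y₂} {p} c₁ c₂ x≢ y≢ cp p≢x₁ p≢x₂ with avoid y₁ y₂
    ... | x , q , cq , _ , _ , q≢y₁ , q≢y₂ with x Fin.≟ x₁ | x Fin.≟ x₂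
    ...   | yes refl | _ = three cp cq c₂ p≢x₁ p≢x₂ x≢ (q≢y₁ ∘ sym) y≢ q≢y₂
    ...   | no x≢x₁ | no x≢x₂ = three c₁ c₂ cq x≢ (x≢x₁ ∘ sym) (x≢x₂ ∘ sym) y≢ (q≢y₁ ∘ sym) (q≢y₂ ∘ sym)
    -- All four known edges, `x₁` `y₁`, `p` `y₁`, `x₂` `y₂` and `x₂` `q`, are covered by `y₁` and
    -- `x₂`. An edge that avoids both is new, and wherever it ends, two of the four complete it to a
    -- matching.
    ...   | no _ | yes refl with avoid y₁ x₂
    ...     | s , t , cs , _ , s≢x₂ , t≢y₁ , _ with s Fin.≟ x₁ | t Fin.≟ y₂
    ...       | yes refl | yes refl = three cp cs cq p≢x₁ p≢x₂ x≢ y≢ (q≢y₁ ∘ sym) (q≢y₂ ∘ sym)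
    ...       | yes refl | no t≢y₂  = three cp cs c₂ p≢x₁ p≢x₂ x≢ (t≢y₁ ∘ sym) y≢ t≢y₂
    ...       | no s≢x₁  | yes refl = three cs cq c₁ s≢x₂ s≢x₁ (x≢ ∘ sym) (q≢y₂ ∘ sym) (y≢ ∘ sym) q≢y₁
    ...       | no s≢x₁  | no t≢y₂  = three cs c₁ c₂ s≢x₁ s≢x₂ x≢ t≢y₁ t≢y₂ y≢

    three-edges : Avoiding → Fin n → Three
    three-edges avoid v with avoid v v
    ... | x₁ , y₁ , c₁ , _ with avoid x₁ y₁
    ...   | x₂ , y₂ , c₂ , x₂≢x₁ , _ , _ , y₂≢y₁ with avoid x₁ x₂
    -- This edge can meet the first two only in its far end; if it does, it is the start of the
    -- alternating path that `augment` asks for, up to exchanging the two edges.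
    ...     | p , y , c , p≢x₁ , p≢x₂ , _ with y Fin.≟ y₁ | y Fin.≟ y₂
    ...       | yes refl | _ = augment avoid c₁ c₂ (x₂≢x₁ ∘ sym) (y₂≢y₁ ∘ sym) c p≢x₁ p≢x₂
    ...       | _ | yes refl = augment avoid c₂ c₁ x₂≢x₁ y₂≢y₁ c p≢x₂ p≢x₁
    ...       | no y≢y₁ | no y≢y₂ = three c₁ c₂ c (x₂≢x₁ ∘ sym) (p≢x₁ ∘ sym) (p≢x₂ ∘ sym) (y₂≢y₁ ∘ sym) (y≢y₁ ∘ sym) (y≢y₂ ∘ sym)

  degSum : Graph n → VSet n → VSet n → ℕ
  degSum G X Y = sumFin (λ u → if X u then degIn G u Y else 0)

  degSum-sym : (G : Graph n) (X Y : VSet n) → degSum G X Y ≡ degSum G Y X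
  degSum-sym {n} G X Y = trans (expand X Y) (trans (sum-swap (λ u w → [ X u ∧ (Y w ∧ adj G u w) ]?))
    (trans (sum-cong (λ w → sum-cong (λ u → cong [_]? (flip u w)))) (sym (expand Y X))))
    where
    expand : ∀ X Y → degSum G X Y ≡ sumFin (λ u → sumFin (λ w → [ X u ∧ (Y w ∧ adj G u w) ]?))
    expand X Y = sum-cong λ u → row u (X u)
      where
      row : ∀ u x → (if x then degIn G u Y else 0) ≡ sumFin (λ w → [ x ∧ (Y w ∧ adj G u w) ]?)
      row u true  = refl
      row u false = sym (trans (sum-const {n} 0) (*-zeroʳ n))
    flip : ∀ u w → X u ∧ (Y w ∧ adj G u w) ≡ Y w ∧ (X u ∧ adj G w u)
    flip u w rewrite Graph.sym G u w with X u | Y w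
    ... | true  | true  = refl
    ... | true  | false = refl
    ... | false | true  = refl
    ... | false | false = refl

  -- The degree bound is the fraction c / e; carrying `e` on the other side keeps the double
  -- counting in the natural numbers.
  degSum-lower : ∀ (G : Graph n) X Y c e → (∀ v → X v ≡ true → c ≤ degIn G v Y * e) →
    count X * c ≤ degSum G X Y * e
  degSum-lower G X Y c e h = subst₂ _≤_ (sum-*ʳ c (λ v → [ X v ]?))
    (sum-*ʳ e (λ v → if X v then degIn G v Y else 0)) (sum-mono λ v → bound v (X v) (h v))
    where
    bound : ∀ v x → (x ≡ true → c ≤ degIn G v Y * e) → [ x ]? * c ≤ (if x then degIn G v Y else 0) * e
    bound v true  h = ≤-trans (≤-reflexive (*-identityˡ c)) (h refl)
    bound v false h = z≤n

  degSum-upper : ∀ (G : Graph n) X Y c e → (∀ v → X v ≡ true → degIn G v Y * e ≤ c) →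
    degSum G X Y * e ≤ count X * c
  degSum-upper G X Y c e h = subst₂ _≤_ (sum-*ʳ e (λ v → if X v then degIn G v Y else 0))
    (sum-*ʳ c (λ v → [ X v ]?)) (sum-mono λ v → bound v (X v) (h v))
    where
    bound : ∀ v x → (x ≡ true → degIn G v Y * e ≤ c) → (if x then degIn G v Y else 0) * e ≤ [ x ]? * c
    bound v true  h = ≤-trans (h refl) (≤-reflexive (sym (*-identityˡ c)))
    bound v false h = z≤n

  -- The size requirement is an arbitrary predicate because the recursion changes it as the
  -- undominated set shrinks.
  record Dominators {n} (G : Graph n) (R X : VSet n) (bound : ℕ → Set) : Set where
    field
      D      : List (Fin n)
      avoids : ∀ d → mem D d ≡ true → R d ≡ false
      covers : ∀ v → X v ≡ true → ∃ λ d → (mem D d ≡ true) × (adj G v d ≡ true)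
      small  : bound (length D)

  add-dominator : ∀ {G : Graph n} {R X} {P Q : ℕ → Set} d → R d ≡ false → (∀ {k} → P k → Q (suc k)) →
    Dominators G R (X ∖ adj G d) P → Dominators G R X Q
  add-dominator {n} {G} {R} {X} d d∉R P⇒Q 𝔻 = record
    { D = d ∷ D ; avoids = avoids′ ; covers = covers′ ; small = P⇒Q small }
    where
    open Dominators 𝔻
    avoids′ : ∀ e → mem (d ∷ D) e ≡ true → R e ≡ false
    avoids′ e e∈ with mem-∷⁻ d D e∈
    ... | inj₁ refl = d∉R
    ... | inj₂ e∈D = avoids e e∈D
    covers′ : ∀ v → X v ≡ true → ∃ λ e → (mem (d ∷ D) e ≡ true) × (adj G v e ≡ true)
    covers′ v Xv with bool-cases (adj G d v)
    ... | inj₁ dv = d , mem-head d D , trans (Graph.sym G v d) dv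
    ... | inj₂ ¬dv with covers v (∧-true⁺ Xv (not-true⁺ ¬dv))
    ...   | e , e∈ , ve = e , mem-∷ d D e∈ , ve

  empty-dominators : ∀ {G : Graph n} {R X} {P : ℕ → Set} → (∀ v → X v ≡ false) → P 0 → Dominators G R X P
  empty-dominators none p0 = record
    { D = [] ; avoids = λ _ () ; covers = λ v Xv → ⊥-elim (true≢false Xv (none v)) ; small = p0 }

  module Domination {n} (G : Graph n) (R : VSet n) (e : ℕ) (0<n : 0 < n)
    (deg : ∀ v → n ≤ degIn G v (compl R) * e) where

    deg>0 : ∀ v → 0 < degIn G v (compl R)
    deg>0 v = *-cancelʳ-< e 0 (degIn G v (compl R)) (≤-trans 0<n (deg v))

    -- The crude bound of one dominator per vertex, for the final stage of `greedy`.
    one-by-one : ∀ k X → count X ≤ k → Dominators G R X (_≤ k)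
    one-by-one k X X≤k with find X
    ... | inj₂ none = empty-dominators none z≤n
    ... | inj₁ (v , Xv) with pick (compl R ∩ adj G v) (λ _ → false) (≤-<-trans (≤-reflexive (trans (sum-const {n} 0) (*-zeroʳ n))) (deg>0 v))
    ...   | d , Pd , _ with ∧-true⁻ {compl R d} Pd
    one-by-one zero X X≤k | inj₁ (v , Xv) | d , Pd , _ | d∉R , vd =
      ⊥-elim (<⇒≱ (≤-trans (s≤s z≤n) (≤-reflexive (sym (count-remove X (λ _ → true) v Xv))))
        (≤-trans (≤-reflexive (count-cong (X ∩ (λ _ → true)) X (λ i → ∧-comm (X i) true))) X≤k))
    one-by-one (suc k) X X≤k | inj₁ (v , Xv) | d , Pd , _ | d∉R , vd =
      add-dominator d (not-true⁻ d∉R) s≤s (one-by-one k (X ∖ adj G d) (s≤s⁻¹ (≤-trans shrinks X≤k)))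
      where
      shrinks : count (X ∖ adj G d) < count X
      shrinks = subst (suc (count (X ∖ adj G d)) ≤_) (sym (count-split X (adj G d)))
        (+-monoˡ-≤ (count (X ∖ adj G d)) hit)
        where
        hit : 1 ≤ count (X ∩ adj G d)
        hit = ≤-trans (≤-trans (s≤s z≤n) (≤-reflexive (sym (count-remove (X ∩ adj G d) (λ _ → true) v
          (∧-true⁺ Xv (trans (Graph.sym G d v) vd)))))) (≤-reflexive (count-cong _ _ (λ i → ∧-comm ((X ∩ adj G d) i) true)))

    -- Once no vertex covers M undominated vertices, double counting the edges into
    -- the undominated set leaves at most e * M of them.
    greedy : ∀ M → 0 < M → ∀ k X → count X ≤ k →
      Dominators G R X (λ d → d * M ≤ count X + e * M * M)
    greedy M 0<M k X X≤k with find (λ w → compl R w ∧ (M ≤ᵇ degIn G w X))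
    ... | inj₂ none with one-by-one (e * M) X X≤B
      where
      low : ∀ w → compl R w ≡ true → degIn G w X ≤ M
      low w w∉R with ≤-total (degIn G w X) M
      ... | inj₁ le = le
      ... | inj₂ ge = ⊥-elim (true≢false (∧-true⁺ w∉R (T⇒true (≤⇒≤ᵇ ge))) (none w))
        where
        T⇒true : ∀ {b} → Data.Bool.T b → b ≡ true
        T⇒true {true} _ = refl
      X≤B : count X ≤ e * M
      X≤B = *-cancelʳ-≤ (count X) (e * M) n {{>-nonZero 0<n}} (begin
        count X * n                 ≤⟨ degSum-lower G X (compl R) n e (λ v _ → deg v) ⟩
        degSum G X (compl R) * e    ≡⟨ cong (_* e) (degSum-sym G X (compl R)) ⟩
        degSum G (compl R) X * e    ≤⟨ degSum-upper G (compl R) X (M * e) e (λ w w∉R → *-monoˡ-≤ e (low w w∉R)) ⟩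
        count (compl R) * (M * e)   ≤⟨ *-monoˡ-≤ (M * e) (count≤n (compl R)) ⟩
        n * (M * e)                 ≡⟨ *-comm n (M * e) ⟩
        M * e * n                   ≡⟨ cong (_* n) (*-comm M e) ⟩
        e * M * n                   ∎)
        where open ≤-Reasoning
    -- The final stage uses at most e * M dominators, which explains the term e * M * M. Every
    -- earlier dominator pays its share `M` by covering at least `M` new vertices.
    ...   | 𝔻 = record { Dominators 𝔻 ; small = ≤-trans (*-monoˡ-≤ M (Dominators.small 𝔻)) (m≤n+m (e * M * M) (count X)) }
    greedy M 0<M k X X≤k | inj₁ (w , Pw) with ∧-true⁻ {compl R w} Pw
    ... | w∉R , hits = add-step k X≤k
      where
      M≤hit : M ≤ count (X ∩ adj G w)
      M≤hit = ≤ᵇ⇒≤ M _ (subst Data.Bool.T (sym hits) _)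
      shrinks : M + count (X ∖ adj G w) ≤ count X
      shrinks = subst (M + count (X ∖ adj G w) ≤_) (sym (count-split X (adj G w))) (+-monoˡ-≤ _ M≤hit)
      add-step : ∀ k → count X ≤ k → Dominators G R X (λ d → d * M ≤ count X + e * M * M)
      add-step zero X≤0 = ⊥-elim (<⇒≱ 0<M (≤-trans (m≤m+n M _) (≤-trans shrinks X≤0)))
      add-step (suc k) X≤k = add-dominator w (not-true⁻ w∉R) (λ {d} → account d)
        (greedy M 0<M k (X ∖ adj G w) (s≤s⁻¹ (≤-trans (+-monoˡ-≤ _ 0<M) (≤-trans shrinks X≤k))))
        where
        account : ∀ d → d * M ≤ count (X ∖ adj G w) + e * M * M → suc d * M ≤ count X + e * M * M
        account d h = begin
          M + d * M                              ≤⟨ +-monoʳ-≤ M h ⟩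
          M + (count (X ∖ adj G w) + e * M * M)      ≡⟨ +-assoc M _ _ ⟨
          M + count (X ∖ adj G w) + e * M * M        ≤⟨ +-monoˡ-≤ (e * M * M) shrinks ⟩
          count X + e * M * M                        ∎
          where open ≤-Reasoning

  -- Growing a connected core

  ∈⇒mem : ∀ {v : Fin n} {xs} → v ∈ xs → mem xs v ≡ true
  ∈⇒mem {v = v} {x ∷ xs} (here refl) = mem-head v xs
  ∈⇒mem {xs = x ∷ xs} (there v∈)     = mem-∷ x xs (∈⇒mem v∈)

  mem⇒∈ : ∀ (xs : List (Fin n)) {v} → mem xs v ≡ true → v ∈ xs
  mem⇒∈ (x ∷ xs) e with mem-∷⁻ x xs e
  ... | inj₁ refl = here refl
  ... | inj₂ h    = there (mem⇒∈ xs h)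

  cntL-elements-single : (p : VSet n) (v : Fin n) → cntL (v ==_) (elements p) ≡ [ p v ]?
  cntL-elements-single p v = trans (cntL-elements p (v ==_))
    (trans (count-cong _ _ (λ w → ∧-comm (p w) (v == w))) (count-single v p))

  elements⁺ : (p : VSet n) {v : Fin n} → p v ≡ true → mem (elements p) v ≡ true
  elements⁺ p {v} pv with cntL>0 (v ==_) (elements p) (≤-reflexive (sym (trans (cntL-elements-single p v) (cong [_]? pv))))
  ... | w , w∈ , e = subst (λ u → mem (elements p) u ≡ true) (sym (==⇒≡ {x = v} e)) (∈⇒mem w∈)

  elements⁻ : (p : VSet n) {v : Fin n} → mem (elements p) v ≡ true → p v ≡ true
  elements⁻ p {v} v∈ with p v | cntL-elements-single p v | ∈⇒cntL>0 (v ==_) (mem⇒∈ (elements p) v∈) (==-refl v)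
  ... | true  | _ | _ = refl
  ... | false | e | h = ⊥-elim (<⇒≢ h (sym e))

  module Growing {n} (G : Graph n) (r : Fin n) (R : VSet n) where

    Grown : List (Fin n) → Set
    Grown S = Rooted G r S × (∀ v → mem S v ≡ true → R v ≡ false)

    record Extension (S : List (Fin n)) (k : ℕ) (xs : VSet n) : Set where
      constructor extension
      field
        S′     : List (Fin n)
        grown  : Grown S′
        old    : ∀ v → mem S v ≡ true → mem S′ v ≡ true
        new    : ∀ v → xs v ≡ true → mem S′ v ≡ true
        length≤ : length S′ ≤ k + length S

    attach : ∀ {S} → Grown S → ∀ u v → mem S u ≡ true → adj G v u ≡ true → R v ≡ false → Extension S 1 (v ==_)
    attach {S} g@(rooted , avoids) u v u∈ vu v∉R with bool-cases (mem S v)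
    ... | inj₁ v∈ = extension S g (λ _ h → h) (λ w e → subst (λ x → mem S x ≡ true) (==⇒≡ e) v∈) (n≤1+n _)
    ... | inj₂ v∉ = extension (v ∷ S) (rooted-∷ rooted u v u∈ v∉ vu , avoids′) (λ _ → mem-∷ v S) (λ w e → ∨-true⁺ˡ e) ≤-refl
      where
      avoids′ : ∀ w → mem (v ∷ S) w ≡ true → R w ≡ false
      avoids′ w w∈ with mem-∷⁻ v S w∈
      ... | inj₁ refl = v∉R
      ... | inj₂ h    = avoids w h

    -- Every vertex is within three steps of the hub of its side, through vertices outside `R`.
    -- Hence one more vertex enlarges the core by at most three.
    module Absorbing (ρ : Bool → Fin n) (side : VSet n)
      (route : ∀ v → ∃ λ w → ∃ λ t → (adj G w (ρ (side v)) ≡ true) × (adj G t w ≡ true) × (adj G v t ≡ true)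
        × (R w ≡ false) × (R t ≡ false)) where

      absorb : ∀ {S} → Grown S → (∀ b → mem S (ρ b) ≡ true) → ∀ v → R v ≡ false → Extension S 3 (v ==_)
      absorb {S} g ρ∈ v v∉R with route v
      ... | w , t , wρ , tw , vt , w∉R , t∉R with attach g _ w (ρ∈ (side v)) wρ w∉R
      ...   | extension S₁ g₁ old₁ new₁ len₁ with attach g₁ w t (new₁ w (==-refl w)) tw t∉R
      ...     | extension S₂ g₂ old₂ new₂ len₂ with attach g₂ t v (new₂ t (==-refl t)) vt v∉R
      ...       | extension S₃ g₃ old₃ new₃ len₃ =
        extension S₃ g₃ (λ x x∈ → old₃ x (old₂ x (old₁ x x∈))) new₃
          (≤-trans len₃ (s≤s (≤-trans len₂ (s≤s len₁))))

      absorb-all : ∀ {S} → Grown S → (∀ b → mem S (ρ b) ≡ true) → ∀ xs → (∀ v → mem xs v ≡ true → R v ≡ false) →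
        Extension S (3 * length xs) (mem xs)
      absorb-all {S} g ρ∈ [] _ = extension S g (λ _ h → h) (λ _ ()) ≤-refl
      absorb-all {S} g ρ∈ (x ∷ xs) xs∉R with absorb g ρ∈ x (xs∉R x (mem-head x xs))
      ... | extension S₁ g₁ old₁ new₁ len₁
        with absorb-all g₁ (λ b → old₁ _ (ρ∈ b)) xs (λ v v∈ → xs∉R v (mem-∷ x xs v∈))
      ...   | extension S₂ g₂ old₂ new₂ len₂ = extension S₂ g₂ (λ v v∈ → old₂ v (old₁ v v∈)) new′
        (≤-trans len₂ (≤-trans (+-monoʳ-≤ (3 * length xs) len₁) (≤-reflexive (total (length xs) (length S)))))
        where
        new′ : ∀ v → mem (x ∷ xs) v ≡ true → mem S₂ v ≡ true
        new′ v v∈ with mem-∷⁻ x xs v∈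
        ... | inj₁ refl = old₂ v (new₁ v (==-refl v))
        ... | inj₂ h    = new₂ v h
        total : ∀ k s → 3 * k + (3 + s) ≡ 3 * suc k + s
        total = solve-∀

  -- Two dense clusters

  module Bounds {n} (large : 3000000 ≤ n) where

    opaque
      avoidable : ∀ {k e w} → k ≤ 9 → e * 1000 ≤ n → n ≤ w * 10 → k + e < w
      avoidable {k} {e} {w} hk he hw =
        linear 1000 (+-mono-≤ (+-mono-≤ (+-mono-≤ he (*-monoˡ-≤ 100 hw)) (*-monoˡ-≤ 1000 hk)) (*-monoˡ-≤ 99 large)) (cert k e w n)
        where
        cert : ∀ k e w n → w * 1000 + (e * 1000 + n * 100 + k * 1000 + 99 * 3000000)
          ≡ suc (k + e) * 1000 + (n + (w * 10) * 100 + 1000 * 9 + n * 99) + 296990000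
        cert = solve-∀

      common : ∀ {k c p q i} → k ≤ 9 → c * 100 ≤ n * 61 → n * 39 ≤ p * 100 → n * 39 ≤ q * 100 → p + q ≤ c + i → k < i
      common {k} {c} {p} {q} {i} hk hc hp hq hi =
        linear 100 (+-mono-≤ (+-mono-≤ (+-mono-≤ hc (+-mono-≤ hp hq)) (*-monoˡ-≤ 100 hi)) (+-mono-≤ (*-monoˡ-≤ 100 hk) (*-monoˡ-≤ 17 large)))
          (cert k c p q i n)
        where
        cert : ∀ k c p q i n →
          i * 100 + (c * 100 + (n * 39 + n * 39) + (p + q) * 100 + (k * 100 + 17 * 3000000))
          ≡ suc k * 100 + (n * 61 + (p * 100 + q * 100) + (c + i) * 100 + (100 * 9 + n * 17)) + 50999000
        cert = solve-∀

      outside-R : ∀ {d o k} → 2 * n ≤ 5 * d → d ≤ o + k → k ≤ 4 → n ≤ o * 3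
      outside-R {d} {o} {k} hd ho hk =
        linear 5 (+-mono-≤ (+-mono-≤ (*-monoˡ-≤ 3 hd) (*-monoˡ-≤ 15 ho)) (+-mono-≤ (*-monoˡ-≤ 15 hk) large)) (cert d o k n)
        where
        cert : ∀ d o k n → (o * 3) * 5 + ((2 * n) * 3 + d * 15 + (k * 15 + 3000000))
          ≡ n * 5 + ((5 * d) * 3 + (o + k) * 15 + (15 * 4 + n)) + 2999940
        cert = solve-∀

      -- The core starts with four vertices, the ends of the third edge and the two hubs, and pays
      -- three for each dominator and each exceptional vertex. This totals at most 6n/1000 + 9004,
      -- and the lower bound on n, rounded up, makes 9004 at most 4n/1000.
      core-size : ∀ {s d e} → s ≤ 3 * d + (3 * e + 4) → d * 1000 ≤ n + 3 * 1000 * 1000 → e * 1000 ≤ n → s * 100 ≤ n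
      core-size {s} {d} {e} hs hd he =
        linear 10 (+-mono-≤ (+-mono-≤ (*-monoˡ-≤ 1000 hs) (*-monoˡ-≤ 3 hd)) (+-mono-≤ (*-monoˡ-≤ 3 he) (*-monoˡ-≤ 4 large))) (cert s d e n)
        where
        cert : ∀ s d e n → n * 10 + (s * 1000 + (d * 1000) * 3 + ((e * 1000) * 3 + 4 * 3000000))
          ≡ (s * 100) * 10 + ((3 * d + (3 * e + 4)) * 1000 + (n + 3 * 1000 * 1000) * 3 + (n * 3 + n * 4)) + 2996000
        cert = solve-∀

      leaf-supply : ∀ {s d o} → s * 100 ≤ n → 2 * n ≤ 5 * d → d ≤ o + s → 3 * s ≤ o
      leaf-supply {s} {d} {o} hs hd ho =
        linear 10 (+-mono-≤ (+-mono-≤ (*-monoˡ-≤ 2 hd) (*-monoˡ-≤ 10 ho)) hs) (cert s d o n)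
        where
        cert : ∀ s d o n → o * 10 + ((2 * n) * 2 + d * 10 + s * 100)
          ≡ (3 * s) * 10 + ((5 * d) * 2 + (o + s) * 10 + n) + (n * 3 + s * 60)
        cert = solve-∀

      -- A good vertex loses at most n/100 + 2 of its 39n/100 neighbours to the core and the two
      -- path ends; twice the remainder is about 76n/100, against at most 61n/100 vertices.
      ore : ∀ {x c w d y s} → x ≤ c → c * 100 ≤ n * 61 → n * 39 ≤ w * 100 → w ≤ d + y → y ≤ 2 + s → s * 100 ≤ n → x + 1 ≤ 2 * d
      ore {x} {c} {w} {d} {y} {s} hx hc hw hd hy hs =
        linear 100 (+-mono-≤ (+-mono-≤ (+-mono-≤ (*-monoˡ-≤ 100 hx) hc) (+-mono-≤ (*-monoˡ-≤ 2 hw) (*-monoˡ-≤ 200 hd)))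
                     (+-mono-≤ (+-mono-≤ (*-monoˡ-≤ 200 hy) (*-monoˡ-≤ 2 hs)) (*-monoˡ-≤ 15 large)))
          (cert x c w d y s n)
        where
        cert : ∀ x c w d y s n →
          (2 * d) * 100 + (x * 100 + c * 100 + ((n * 39) * 2 + w * 200) + (y * 200 + (s * 100) * 2 + 15 * 3000000))
          ≡ (x + 1) * 100 + (c * 100 + n * 61 + ((w * 100) * 2 + (d + y) * 200) + ((2 + s) * 200 + n * 2 + n * 15)) + 44999500
        cert = solve-∀

      escapes : ∀ {k s w} → k ≤ 3 + s → s * 100 ≤ n → n ≤ w * 10 → k < w
      escapes {k} {s} {w} hk hs hw =
        linear 100 (+-mono-≤ (+-mono-≤ (*-monoˡ-≤ 100 hk) hs) (+-mono-≤ (*-monoˡ-≤ 10 hw) (*-monoˡ-≤ 9 large))) (cert k s w n)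
        where
        cert : ∀ k s w n → w * 100 + (k * 100 + s * 100 + (n * 10 + 9 * 3000000))
          ≡ suc k * 100 + ((3 + s) * 100 + n + ((w * 10) * 10 + n * 9)) + 26999600
        cert = solve-∀

      many-leaves : ∀ {s c o} → s * 100 ≤ n → c ≤ s → n ≤ c + o → 3 ≤ o
      many-leaves {s} {c} {o} hs hc ho =
        linear 100 (+-mono-≤ (+-mono-≤ hs (*-monoˡ-≤ 100 hc)) (+-mono-≤ (*-monoˡ-≤ 100 ho) (*-monoˡ-≤ 99 large))) (cert s c o n)
        where
        cert : ∀ s c o n → o * 100 + (s * 100 + c * 100 + (n * 100 + 99 * 3000000))
          ≡ 100 * 3 + (n + s * 100 + ((c + o) * 100 + n * 99)) + 296999700
        cert = solve-∀

      other-side : ∀ {c o} → o * 100 ≤ n * 61 → n ≤ c + o → 2 < c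
      other-side {c} {o} ho hn =
        linear 100 (+-mono-≤ (+-mono-≤ ho (*-monoˡ-≤ 100 hn)) (*-monoˡ-≤ 39 large)) (cert c o n)
        where
        cert : ∀ c o n → c * 100 + (o * 100 + n * 100 + 39 * 3000000)
          ≡ 100 * 3 + (n * 61 + (c + o) * 100 + n * 39) + 116999700
        cert = solve-∀

  cell : VSet n → Bool → VSet n
  cell side true  = side
  cell side false = compl side

  cell⁺ : ∀ (side : VSet n) {b v} → side v ≡ b → cell side b v ≡ true
  cell⁺ side {true}  e = e
  cell⁺ side {false} e = not-true⁺ e

  cell⁻ : ∀ (side : VSet n) b {v} → cell side b v ≡ true → side v ≡ b
  cell⁻ side true  e = e
  cell⁻ side false e = not-true⁻ e

  ownDegree : Graph n → VSet n → Fin n → ℕ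
  ownDegree G side v = degIn G v (cell side (side v))

  -- Cells have at most 61n/100 vertices, so twice 39n/100 leaves room for Ore's condition inside a cell.
  good : Graph n → VSet n → VSet n
  good {n} G side v = n * 39 ≤ᵇ ownDegree G side v * 100

  good⁻ : ∀ (G : Graph n) side v → good G side v ≡ true → n * 39 ≤ ownDegree G side v * 100
  good⁻ G side v e = ≤ᵇ⇒≤ _ _ (subst Data.Bool.T (sym e) _)

  module TwoClusters {n} (G : Graph n) (side : VSet n) (large : 3000000 ≤ n) (3-conn : KConnected 3 G)
    (degree≥ : ∀ v → 2 * n ≤ 5 * degree G v)
    (cells≤ : ∀ b → count (cell side b) * 100 ≤ n * 61)
    (own≥ : ∀ v → n ≤ ownDegree G side v * 10)
    (few : count (compl (good G side)) * 1000 ≤ n)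
    where

    open Bounds large
    open Matching G side

    cell₂ = cell side

    0<n : 0 < n
    0<n = ≤-trans (s≤s z≤n) large

    v₀ : Fin n
    v₀ = Fin.fromℕ< 0<n

    opaque
      matching : Three
      matching = three-edges (avoiding 3-conn
        (other-side (cells≤ false) (≤-reflexive (sym (count-compl side))))
        (other-side (cells≤ true) (≤-reflexive (sym (trans (+-comm _ (count side)) (count-compl side)))))) v₀

    open Three matching

    own≥′ : ∀ {b v} → side v ≡ b → n ≤ degIn G v (cell₂ b) * 10
    own≥′ {v = v} refl = own≥ v

    A B : Bool → Fin n
    A true  = x₁
    A false = y₁
    B true  = x₂
    B false = y₂

    side-A : ∀ b → side (A b) ≡ b
    side-A true  = proj₁ e₁
    side-A false = proj₁ (proj₂ e₁)

    side-B : ∀ b → side (B b) ≡ b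
    side-B true  = proj₁ e₂
    side-B false = proj₁ (proj₂ e₂)

    A≢B : ∀ b → A b ≢ B b
    A≢B true  = x₁≢x₂
    A≢B false = y₁≢y₂

    reserved : List (Fin n)
    reserved = A true ∷ B true ∷ A false ∷ B false ∷ []

    R : VSet n
    R = mem reserved

    A∈R : ∀ b → R (A b) ≡ true
    A∈R true  = mem-head (A true) (B true ∷ A false ∷ B false ∷ [])
    A∈R false = mem-∷ (A true) (B true ∷ A false ∷ B false ∷ []) (mem-∷ (B true) (A false ∷ B false ∷ []) (mem-head (A false) (B false ∷ [])))

    B∈R : ∀ b → R (B b) ≡ true
    B∈R true  = mem-∷ (A true) (B true ∷ A false ∷ B false ∷ []) (mem-head (B true) (A false ∷ B false ∷ []))
    B∈R false = mem-∷ (A true) (B true ∷ A false ∷ B false ∷ []) (mem-∷ (B true) (A false ∷ B false ∷ [])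
      (mem-∷ (A false) (B false ∷ []) (mem-head (B false) [])))

    ∉R : ∀ {v} → (∀ b → v ≢ A b) → (∀ b → v ≢ B b) → R v ≡ false
    ∉R h k = ∉-∷⁺ (A true) (B true ∷ A false ∷ B false ∷ []) (h true)
      (∉-∷⁺ (B true) (A false ∷ B false ∷ []) (k true) (∉-∷⁺ (A false) (B false ∷ []) (h false) (∉-∷⁺ (B false) [] (k false) refl)))

    R⁻ : ∀ {v} → R v ≡ true → (v ≡ A (side v)) ⊎ (v ≡ B (side v))
    R⁻ {v} e with mem-∷⁻ (A true) (B true ∷ A false ∷ B false ∷ []) e
    ... | inj₁ refl rewrite side-A true = inj₁ refl
    ... | inj₂ e with mem-∷⁻ (B true) (A false ∷ B false ∷ []) e
    ...   | inj₁ refl rewrite side-B true = inj₂ refl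
    ...   | inj₂ e with mem-∷⁻ (A false) (B false ∷ []) e
    ...     | inj₁ refl rewrite side-A false = inj₁ refl
    ...     | inj₂ e with mem-∷⁻ (B false) [] e
    ...       | inj₁ refl rewrite side-B false = inj₂ refl

    other : ∀ {b c u v} → side u ≡ b → side v ≡ c → b ≢ c → u ≢ v
    other su sv b≢c refl = b≢c (trans (sym su) sv)

    x₃∉R : R x₃ ≡ false
    x₃∉R = ∉R (λ { true → x₁≢x₃ ∘ sym ; false → other {true} {false} (proj₁ e₃) (side-A false) (λ ()) })
              (λ { true → x₂≢x₃ ∘ sym ; false → other {true} {false} (proj₁ e₃) (side-B false) (λ ()) })

    y₃∉R : R y₃ ≡ false
    y₃∉R = ∉R (λ { false → y₁≢y₃ ∘ sym ; true → other {false} {true} (proj₁ (proj₂ e₃)) (side-A true) (λ ()) })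
              (λ { false → y₂≢y₃ ∘ sym ; true → other {false} {true} (proj₁ (proj₂ e₃)) (side-B true) (λ ()) })

    opaque
      -- The n/10 neighbours on the own side outnumber the four reserved vertices and the n/1000 bad
      -- ones. Thus even an exceptional vertex is one step from a good one.
      friend : ∀ v → ∃ λ t → (adj G v t ≡ true) × (side t ≡ side v) × (good G side t ≡ true) × (R t ≡ false)
      friend v with pick (cell₂ (side v) ∩ adj G v) (R ∪ compl (good G side))
        (≤-<-trans (count-mem-∪ reserved (compl (good G side)))
          (avoidable {4} {count (compl (good G side))} {ownDegree G side v} (s≤s (s≤s (s≤s (s≤s z≤n)))) few (own≥ v)))
      ... | t , Pt , t∉ with ∧-true⁻ {cell₂ (side v) t} Pt | ∨-false⁻ {R t} t∉
      ...   | t∈cell , vt | t∉R , ¬bad = t , vt , cell⁻ side (side v) t∈cell , not-false⁻ ¬bad , t∉R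
        where
        not-false⁻ : ∀ {x} → not x ≡ false → x ≡ true
        not-false⁻ {true} _ = refl

    opaque
      -- Two neighbourhoods of 39n/100 in a cell of at most 61n/100 share at least 17n/100 vertices,
      -- more than the four reserved ones.
      common-friend : ∀ s t → good G side s ≡ true → good G side t ≡ true → side t ≡ side s →
        ∃ λ w → (adj G s w ≡ true) × (adj G t w ≡ true) × (R w ≡ false)
      common-friend s t gs gt same with good⁻ G side t gt
      ... | gt′ rewrite same with pick∉ ((cell₂ (side s) ∩ adj G s) ∩ (cell₂ (side s) ∩ adj G t)) reserved
        (common {4} {count (cell₂ (side s))} {count (cell₂ (side s) ∩ adj G s)} {count (cell₂ (side s) ∩ adj G t)} (s≤s (s≤s (s≤s (s≤s z≤n)))) (cells≤ (side s)) (good⁻ G side s gs) gt′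
          (count-∩ (cell₂ (side s) ∩ adj G s) (cell₂ (side s) ∩ adj G t) (cell₂ (side s))
            (λ _ e → proj₁ (∧-true⁻ e)) (λ _ e → proj₁ (∧-true⁻ e))))
      ...   | w , Pw , w∉R with ∧-true⁻ {(cell₂ (side s) ∩ adj G s) w} Pw
      ...     | Ps , Pt = w , proj₂ (∧-true⁻ {cell₂ (side s) w} Ps) , proj₂ (∧-true⁻ {cell₂ (side s) w} Pt) , w∉R

    -- The edge x₃ y₃ joins the two halves of the tree, each of which is built around its hub.
    hub : Bool → Fin n
    hub true  = proj₁ (friend x₃)
    hub false = proj₁ (friend y₃)

    hub-side : ∀ b → side (hub b) ≡ b
    hub-side true  = trans (proj₁ (proj₂ (proj₂ (friend x₃)))) (proj₁ e₃)
    hub-side false = trans (proj₁ (proj₂ (proj₂ (friend y₃)))) (proj₁ (proj₂ e₃))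

    hub-good : ∀ b → good G side (hub b) ≡ true
    hub-good true  = proj₁ (proj₂ (proj₂ (proj₂ (friend x₃))))
    hub-good false = proj₁ (proj₂ (proj₂ (proj₂ (friend y₃))))

    -- The hub is good and so is the friend `t` of `v`, hence these two have a common neighbour.
    route : ∀ v → ∃ λ w → ∃ λ t → (adj G w (hub (side v)) ≡ true) × (adj G t w ≡ true) × (adj G v t ≡ true)
      × (R w ≡ false) × (R t ≡ false)
    route v with friend v
    ... | t , vt , st , gt , t∉R with common-friend (hub (side v)) t (hub-good (side v)) gt (trans st (sym (hub-side (side v))))
    ...   | w , hw , tw , w∉R = w , t , trans (Graph.sym G w _) hw , tw , vt , w∉R , t∉R

    open Growing G x₃ R
    open Absorbing hub side route

    degree-outside : ∀ v (S : VSet n) → degree G v ≤ degIn G v (compl S) + count S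
    degree-outside v S = ≤-trans (count-∖ (adj G v) S) (+-monoˡ-≤ (count S)
      (≤-reflexive (count-cong _ _ (λ w → ∧-comm (adj G v w) (not (S w))))))

    opaque
      dominators : Dominators G R (λ _ → true) (λ d → d * 1000 ≤ count {n} (λ _ → true) + 3 * 1000 * 1000)
      -- Every vertex has at least 2n/5 - 4, hence n/3, neighbours outside `R`, which gives the 3.
      -- With `M` = 1000 there are at most n/1000 + 3000 dominators.
      dominators = Domination.greedy G R 3 0<n (λ v → outside-R (degree≥ v) (degree-outside v R) (count-mem reserved))
        1000 (s≤s z≤n) _ (λ _ → true) ≤-refl

    open Dominators dominators

    -- Reserved vertices are left out even when bad: they have to be leaves, and `side-path` asks
    -- less of them.
    exceptional : VSet n
    exceptional = compl (good G side) ∖ R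

    record TreeCore : Set where
      field
        S           : List (Fin n)
        rooted      : Rooted G x₃ S
        reserves    : ∀ v → mem S v ≡ true → R v ≡ false
        dominating  : ∀ v → ∃ λ u → (mem S u ≡ true) × (adj G v u ≡ true)
        rest-good   : ∀ v → mem S v ≡ false → R v ≡ false → good G side v ≡ true
        small-core  : length S * 100 ≤ n

    opaque
      tree-core : TreeCore
      tree-core with attach (rooted-singleton G x₃ , start) x₃ y₃ (mem-head x₃ []) (trans (Graph.sym G y₃ x₃) (proj₂ (proj₂ e₃))) y₃∉R
        where
        start : ∀ v → mem (x₃ ∷ []) v ≡ true → R v ≡ false
        start v v∈ with mem-∷⁻ x₃ [] v∈
        ... | inj₁ refl = x₃∉R
      ... | extension S₁ g₁ old₁ new₁ len₁
        with attach g₁ x₃ (hub true) (old₁ x₃ (mem-head x₃ [])) (trans (Graph.sym G _ x₃) (proj₁ (proj₂ (friend x₃)))) (proj₂ (proj₂ (proj₂ (proj₂ (friend x₃)))))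
      ...   | extension S₂ g₂ old₂ new₂ len₂
        with attach g₂ y₃ (hub false) (old₂ y₃ (new₁ y₃ (==-refl y₃))) (trans (Graph.sym G _ y₃) (proj₁ (proj₂ (friend y₃)))) (proj₂ (proj₂ (proj₂ (proj₂ (friend y₃)))))
      ...     | extension S₃ g₃ old₃ new₃ len₃
        with absorb-all g₃ (λ { true → old₃ _ (new₂ _ (==-refl (hub true))) ; false → new₃ _ (==-refl (hub false)) })
               (elements exceptional) (λ v v∈ → not-true⁻ (proj₂ (∧-true⁻ {not (good G side v)} (elements⁻ exceptional v∈))))
      ...       | extension S₄ g₄ old₄ new₄ len₄
        with absorb-all g₄ (λ { true → old₄ _ (old₃ _ (new₂ _ (==-refl (hub true)))) ; false → old₄ _ (new₃ _ (==-refl (hub false))) })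
               D avoids
      ...         | extension S₅ g₅ old₅ new₅ len₅ = record
        { S = S₅
        ; rooted = proj₁ g₅
        ; reserves = proj₂ g₅
        ; dominating = λ v → let d , d∈ , vd = covers v refl in d , new₅ d d∈ , vd
        ; rest-good = rest
        ; small-core = core-size {d = length D} {e = length (elements exceptional)}
            (≤-trans len₅ (+-monoʳ-≤ (3 * length D) (≤-trans len₄ (+-monoʳ-≤ (3 * length (elements exceptional))
              (≤-trans len₃ (s≤s (≤-trans len₂ (s≤s len₁))))))))
            (subst (λ k → length D * 1000 ≤ k + 3 * 1000 * 1000) (count-true {n}) small)
            (≤-trans (*-monoˡ-≤ 1000 (≤-trans (≤-reflexive (length-elements exceptional))
              (count-mono exceptional (compl (good G side)) (λ _ e → proj₁ (∧-true⁻ e))))) few)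
        }
        where
        rest : ∀ v → mem S₅ v ≡ false → R v ≡ false → good G side v ≡ true
        rest v v∉ v∉R with bool-cases (good G side v)
        ... | inj₁ e = e
        ... | inj₂ e = ⊥-elim (true≢false (old₅ v (new₄ v (elements⁺ exceptional (∧-true⁺ (not-true⁺ e) (not-true⁺ v∉R))))) v∉)

    open TreeCore tree-core

    leaves : VSet n
    leaves = compl (mem S)

    ∈R⇒leaf : ∀ {v} → R v ≡ true → leaves v ≡ true
    ∈R⇒leaf {v} v∈R with bool-cases (mem S v)
    ... | inj₁ e = ⊥-elim (true≢false v∈R (reserves v e))
    ... | inj₂ e = not-true⁺ e

    opaque
      -- Ore's condition may fail at `A b` and `B b`, so both are removed first. Each has n/10
      -- neighbours on its side, enough to choose distinct `a` and `c` among the remaining leaves;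
      -- the Hamilton path from `a` to `c` is then extended by one vertex at either end.
      side-path : ∀ b → Σ (Seg (A b) (B b)) λ s → Spans (cell₂ b ∩ leaves) s × bad G s ≡ 0
      side-path b with pick∉ (cell₂ b ∩ adj G (A b)) (A b ∷ B b ∷ S) (escapes (n≤1+n _) small-core (own≥′ (side-A b)))
      ... | a , Pa , a∉ with pick∉ (cell₂ b ∩ adj G (B b)) (a ∷ A b ∷ B b ∷ S) (escapes ≤-refl small-core (own≥′ (side-B b)))
      ...   | c , Pc , c∉ with ∧-true⁻ {cell₂ b a} Pa | ∧-true⁻ {cell₂ b c} Pc | ∉-∷⁻ a (A b ∷ B b ∷ S) c∉
      ...     | a∈ , Aa | c∈ , Bc | c≢a , c∉′ = enclose (hamiltonian-connected G X dense a c (c≢a ∘ sym) (X⁺ a∈ a∉) (X⁺ c∈ c∉′))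
        where
        Z X : VSet n
        Z = cell₂ b ∩ leaves
        X = (Z ∖ (A b ==_)) ∖ (B b ==_)
        X⁺ : ∀ {v} → cell₂ b v ≡ true → mem (A b ∷ B b ∷ S) v ≡ false → X v ≡ true
        X⁺ {v} v∈ v∉ with ∉-∷⁻ (A b) (B b ∷ S) v∉
        ... | v≢A , v∉′ with ∉-∷⁻ (B b) S v∉′
        ...   | v≢B , v∉S = ∧-true⁺ (∧-true⁺ (∧-true⁺ v∈ (not-true⁺ v∉S)) (not-true⁺ (≢⇒== (v≢A ∘ sym)))) (not-true⁺ (≢⇒== (v≢B ∘ sym)))
        dense : OreDense G X
        dense v Xv with ∧-true⁻ {(Z ∖ (A b ==_)) v} Xv
        ... | Xv′ , B≠v with ∧-true⁻ {Z v} Xv′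
        ...   | Zv , A≠v with ∧-true⁻ {cell₂ b v} Zv
        ...     | v∈ , v∉S with cell⁻ side b v∈
        ...       | refl = ore
          (count-mono X (cell₂ b) (λ w e → proj₁ (∧-true⁻ (proj₁ (∧-true⁻ (proj₁ (∧-true⁻ {(Z ∖ (A b ==_)) w} e)))))))
          (cells≤ b) (good⁻ G side v v-good)
          (≤-trans (count-∖ (cell₂ b ∩ adj G v) (mem (A b ∷ B b ∷ S))) (+-monoˡ-≤ _ (count-mono _ (X ∩ adj G v) into)))
          (count-mem (A b ∷ B b ∷ S)) small-core
          where
          -- The only reserved vertices on side `b` are `A b` and `B b`, and neither is in `X`.
          v∉R : R v ≡ false
          v∉R with bool-cases (R v)
          ... | inj₂ e = e
          ... | inj₁ e with R⁻ e
          ...   | inj₁ v≡A = ⊥-elim (==-false⇒≢ (not-true⁻ A≠v) (sym v≡A))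
          ...   | inj₂ v≡B = ⊥-elim (==-false⇒≢ (not-true⁻ B≠v) (sym v≡B))
          v-good : good G side v ≡ true
          v-good = rest-good v (not-true⁻ v∉S) v∉R
          into : ∀ w → ((cell₂ b ∩ adj G v) ∖ mem (A b ∷ B b ∷ S)) w ≡ true → (X ∩ adj G v) w ≡ true
          into w e with ∧-true⁻ {(cell₂ b ∩ adj G v) w} e
          ... | e₁ , w∉ with ∧-true⁻ {cell₂ b w} e₁
          ...   | w∈ , vw = ∧-true⁺ (X⁺ w∈ (not-true⁻ w∉)) vw
        enclose : (Σ (Seg a c) λ s → Spans X s × bad G s ≡ 0) → Σ (Seg (A b) (B b)) λ s → Spans Z s × bad G s ≡ 0
        enclose (s , spans , bad≡0) = A b ∷ (s ⧺ end (B b)) , spans′ , bad′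
          where
          spans′ : Spans Z (A b ∷ (s ⧺ end (B b)))
          spans′ f rewrite cnt-⧺ f s (end (B b)) | spans f =
            sym (trans (count-remove Z f (A b) (∧-true⁺ (cell⁺ side (side-A b)) (∈R⇒leaf (A∈R b))))
              (cong ([ f (A b) ]? +_) (trans (count-remove (Z ∖ (A b ==_)) f (B b)
                (∧-true⁺ (∧-true⁺ (cell⁺ side (side-B b)) (∈R⇒leaf (B∈R b))) (not-true⁺ (≢⇒== (A≢B b)))))
                (+-comm [ f (B b) ]? _))))
          bad′ : bad G (A b ∷ (s ⧺ end (B b))) ≡ 0
          bad′ rewrite bad-⧺ G s (end (B b)) | bad≡0 | Aa | trans (Graph.sym G c (B b)) Bc = refl

    halin : HasSpanningGenHalin G
    halin with side-path true | side-path false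
    ... | s , spans-s , bad-s | t , spans-t , bad-t
      with hist-with-core G rooted (λ v _ → dominating v)
             (λ v _ → leaf-supply small-core (degree≥ v) (≤-trans (degree-outside v (mem S)) (+-monoʳ-≤ _ (count-mem S))))
    ...   | T , hist , ∉S⇒leaf , leaf⇒∉S
      -- The path `s` runs from `x₁` to `x₂` and the reversed `t` from `y₂` to `y₁`, so the junction
      -- is the second matching edge and the closing edge is the first.
      with spanning-cycle G leaves (s ⧺ rev t) spans bad≡0 (trans (Graph.sym G y₁ x₁) (proj₂ (proj₂ e₁)))
             (many-leaves small-core (count-mem S) (≤-reflexive (sym (count-compl (mem S)))))
      where
      spans : Spans leaves (s ⧺ rev t)
      spans f rewrite cnt-⧺ f s (rev t) | cnt-rev f t | spans-s f | spans-t f =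
        sym (trans (count-split (leaves ∩ f) side) (cong₂ _+_
          (count-cong _ _ (λ v → reorder (leaves v) (f v) (side v)))
          (count-cong _ _ (λ v → reorder (leaves v) (f v) (not (side v))))))
        where
        reorder : ∀ x y z → (x ∧ y) ∧ z ≡ (z ∧ x) ∧ y
        reorder true  y true  = ∧-comm y true
        reorder true  y false = ∧-comm y false
        reorder false y true  = refl
        reorder false y false = refl
      bad≡0 : bad G (s ⧺ rev t) ≡ 0
      bad≡0 rewrite bad-⧺ G s (rev t) | bad-rev G t | bad-s | bad-t | proj₂ (proj₂ e₂) = refl
    ...     | cycle , on⇒leaf , leaf⇒on = T , toList (s ⧺ rev t) , hist , cycle ,
      λ v → mk⇔ (λ v∈ → ∉S⇒leaf v (not-true⁻ (on⇒leaf v v∈))) (λ l → leaf⇒on v (not-true⁺ (leaf⇒∉S v l)))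

  -- From the given partition to clusters

  module Reassignment {n} (G : Graph n) (V₁ : VSet n) (large : 3000000 ≤ n)
    (degree≥ : ∀ v → 2 * n + 3 ≤ 5 * degree G v)
    (big₁ : n * 39999 ≤ count V₁ * 100000)
    (big₂ : n * 39999 ≤ count (compl V₁) * 100000)
    (sparse : ∀ v → V₁ v ≡ true → degIn G v (compl V₁) * 200000 ≤ n)
    where

    V₂ : VSet n
    V₂ = compl V₁

    d₁ d₂ : Fin n → ℕ
    d₁ v = degIn G v V₁
    d₂ v = degIn G v V₂

    -- Degrees across are bounded from the `V₁` end only. A vertex of `V₂` may therefore have many
    -- neighbours in `V₁`; those with more than n/200 form `attached`, and they can only be shown to
    -- be few.
    moved attached side : VSet n
    moved v    = V₂ v ∧ (d₂ v ≤ᵇ d₁ v)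
    attached v = V₂ v ∧ not (d₁ v * 200 ≤ᵇ n)
    side       = V₁ ∪ moved

    ≤ᵇ-true : ∀ {a b} → (a ≤ᵇ b) ≡ true → a ≤ b
    ≤ᵇ-true {a} {b} e = ≤ᵇ⇒≤ a b (subst Data.Bool.T (sym e) _)

    true-≤ᵇ : ∀ {a b} → a ≤ b → (a ≤ᵇ b) ≡ true
    true-≤ᵇ {a} {b} h with a ≤ᵇ b | ≤⇒≤ᵇ h
    ... | true | _ = refl

    ≤ᵇ-false : ∀ {a b} → (a ≤ᵇ b) ≡ false → b ≤ a
    ≤ᵇ-false {a} {b} e with ≤-total a b
    ... | inj₁ le = ⊥-elim (true≢false (true-≤ᵇ le) e)
    ... | inj₂ ge = ge

    degrees : ∀ v → 2 * n + 3 ≤ 5 * (d₁ v + d₂ v)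
    degrees v = subst (λ d → 2 * n + 3 ≤ 5 * d) (trans (count-split (adj G v) V₁) (cong₂ _+_
      (count-cong _ _ (λ w → ∧-comm (adj G v w) (V₁ w))) (count-cong _ _ (λ w → ∧-comm (adj G v w) (V₂ w))))) (degree≥ v)

    opaque
      -- Double counting between `attached` and `V₁`: at least n/200 edges at each attached vertex,
      -- at most n/200000 at each of at most n vertices of `V₁`.
      attached-few : count attached * 1000 ≤ n
      attached-few = *-cancelʳ-≤ (count attached * 1000) n n {{>-nonZero (≤-trans (s≤s z≤n) large)}} (begin
        count attached * 1000 * n             ≡⟨ *-assoc (count attached) 1000 n ⟩
        count attached * (1000 * n)           ≡⟨ cong (count attached *_) (*-comm 1000 n) ⟩
        count attached * (n * 1000)           ≤⟨ degSum-lower G attached V₁ (n * 1000) 200000 many ⟩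
        degSum G attached V₁ * 200000         ≡⟨ cong (_* 200000) (degSum-sym G attached V₁) ⟩
        degSum G V₁ attached * 200000         ≤⟨ degSum-upper G V₁ attached n 200000 low ⟩
        count V₁ * n                          ≤⟨ *-monoˡ-≤ n (count≤n V₁) ⟩
        n * n                                 ∎)
        where
        open ≤-Reasoning
        many : ∀ v → attached v ≡ true → n * 1000 ≤ d₁ v * 200000
        many v e = ≤-trans (*-monoˡ-≤ 1000 (≤ᵇ-false {d₁ v * 200} {n} (not-true⁻ (proj₂ (∧-true⁻ {V₂ v} e)))))
          (≤-reflexive (*-assoc (d₁ v) 200 1000))
        low : ∀ v → V₁ v ≡ true → degIn G v attached * 200000 ≤ n
        low v e = ≤-trans (*-monoˡ-≤ 200000 (count-mono _ _
          (λ w h → let aw , vw = ∧-true⁻ {attached w} h in ∧-true⁺ (proj₁ (∧-true⁻ {V₂ w} aw)) vw))) (sparse v e)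

      -- At least half of the neighbours, so at least n/5, lie in `V₁`. Hence moving changes the
      -- sides by at most n/1000 vertices.
      moved⇒attached : ∀ v → moved v ≡ true → attached v ≡ true
      moved⇒attached v e with ∧-true⁻ {V₂ v} e
      ... | v∈V₂ , m with bool-cases (d₁ v * 200 ≤ᵇ n)
      ...   | inj₂ h = ∧-true⁺ v∈V₂ (not-true⁺ h)
      ...   | inj₁ h = ⊥-elim (<⇒≱ (linear 1 (+-mono-≤ (*-monoˡ-≤ 20 (degrees v)) (*-monoˡ-≤ 100 (≤ᵇ-true {d₂ v} {d₁ v} m)))
                          (cert (d₁ v) (d₂ v) n)) (≤ᵇ-true {d₁ v * 200} {n} h))
        where
        cert : ∀ x y n → (x * 200) * 1 + ((2 * n + 3) * 20 + y * 100)
          ≡ suc n * 1 + ((5 * (x + y)) * 20 + x * 100) + (39 * n + 59)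
        cert = solve-∀

      own-moved : ∀ v → side v ≡ true → d₁ v ≤ ownDegree G side v
      own-moved v e rewrite e = count-mono _ _
        (λ w h → let w∈ , vw = ∧-true⁻ {V₁ w} h in ∧-true⁺ (∨-true⁺ˡ w∈) vw)

      own-unmoved : ∀ v → side v ≡ false → d₂ v ≤ ownDegree G side v + count attached
      own-unmoved v e rewrite e = ≤-trans (count-∖ (V₂ ∩ adj G v) attached) (+-monoˡ-≤ (count attached) (count-mono _ _ stays))
        where
        stays : ∀ w → ((V₂ ∩ adj G v) ∖ attached) w ≡ true → (compl side ∩ adj G v) w ≡ true
        stays w h with ∧-true⁻ {(V₂ ∩ adj G v) w} h
        ... | h′ , w∉ with ∧-true⁻ {V₂ w} h′
        ...   | w∈V₂ , vw = ∧-true⁺ (not-true⁺ unmoved) vw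
          where
          unmoved : side w ≡ false
          unmoved with bool-cases (side w)
          ... | inj₂ k = k
          ... | inj₁ k with ∨-true⁻ {V₁ w} k
          ...   | inj₁ w∈V₁ = ⊥-elim (true≢false w∈V₁ (not-true⁻ w∈V₂))
          ...   | inj₂ m    = ⊥-elim (true≢false (moved⇒attached w m) (not-true⁻ w∉))

      -- A vertex of `V₁` loses at most n/200000 of its 2n/5 neighbours. An unattached one of `V₂`
      -- loses n/200 to `V₁` and n/1000 to moved vertices, which leaves 394n/1000.
      good-or-attached : ∀ v → (n * 39 ≤ ownDegree G side v * 100) ⊎ (attached v ≡ true)
      good-or-attached v with bool-cases (V₁ v) | bool-cases (attached v)
      ... | inj₁ v∈V₁ | _ = inj₁ (linear 2000 (+-mono-≤ (+-mono-≤ (*-monoˡ-≤ 40000 (degrees v)) (sparse v v∈V₁))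
              (*-monoˡ-≤ 200000 (own-moved v (∨-true⁺ˡ v∈V₁)))) (cert (d₁ v) (d₂ v) (ownDegree G side v) n))
        where
        cert : ∀ x y w n → (w * 100) * 2000 + ((2 * n + 3) * 40000 + y * 200000 + x * 200000)
          ≡ (n * 39) * 2000 + ((5 * (x + y)) * 40000 + n + w * 200000) + (1999 * n + 120000)
        cert = solve-∀
      ... | inj₂ _ | inj₁ a = inj₂ a
      ... | inj₂ v∉V₁ | inj₂ ¬a = inj₁ (linear 10 (+-mono-≤ (+-mono-≤ (*-monoˡ-≤ 200 (degrees v)) (*-monoˡ-≤ 5 d₁-small))
              (+-mono-≤ (*-monoˡ-≤ 1000 (own-unmoved v unmoved)) attached-few))
              (cert (d₁ v) (d₂ v) (ownDegree G side v) (count attached) n))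
        where
        d₁-small : d₁ v * 200 ≤ n
        d₁-small with bool-cases (d₁ v * 200 ≤ᵇ n)
        ... | inj₁ h = ≤ᵇ-true {d₁ v * 200} h
        ... | inj₂ h = ⊥-elim (true≢false (∧-true⁺ (not-true⁺ v∉V₁) (not-true⁺ h)) ¬a)
        unmoved : side v ≡ false
        unmoved with bool-cases (side v)
        ... | inj₂ k = k
        ... | inj₁ k with ∨-true⁻ {V₁ v} k
        ...   | inj₁ v∈V₁ = ⊥-elim (true≢false v∈V₁ v∉V₁)
        ...   | inj₂ m    = ⊥-elim (true≢false (moved⇒attached v m) ¬a)
        cert : ∀ x y w b n → (w * 100) * 10 + ((2 * n + 3) * 200 + (x * 200) * 5 + (y * 1000 + b * 1000))
          ≡ (n * 39) * 10 + ((5 * (x + y)) * 200 + n * 5 + ((w + b) * 1000 + n)) + (4 * n + 600)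
        cert = solve-∀

      few : count (compl (good G side)) * 1000 ≤ n
      few = ≤-trans (*-monoˡ-≤ 1000 (count-mono _ _ bad⇒attached)) attached-few
        where
        bad⇒attached : ∀ v → compl (good G side) v ≡ true → attached v ≡ true
        bad⇒attached v ¬g with good-or-attached v
        ... | inj₁ g = ⊥-elim (true≢false (true-≤ᵇ g) (not-true⁻ ¬g))
        ... | inj₂ a = a

      -- A vertex of `V₂` ends up where it has the majority of its neighbours, at least n/5, and the
      -- moves of others cost at most n/1000. Vertices of `V₁` are good.
      own≥ : ∀ v → n ≤ ownDegree G side v * 10
      own≥ v with bool-cases (side v) | bool-cases (V₁ v)
      ... | inj₁ s | inj₂ v∉V₁ = linear 1 (+-mono-≤ (+-mono-≤ (degrees v) (*-monoˡ-≤ 5 (≤ᵇ-true {d₂ v} {d₁ v} still)))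
              (*-monoˡ-≤ 10 (own-moved v s))) (cert (d₁ v) (d₂ v) (ownDegree G side v) n)
        where
        still : (d₂ v ≤ᵇ d₁ v) ≡ true
        still with ∨-true⁻ {V₁ v} s
        ... | inj₁ v∈V₁ = ⊥-elim (true≢false v∈V₁ v∉V₁)
        ... | inj₂ m    = proj₂ (∧-true⁻ {V₂ v} m)
        cert : ∀ x y w n → (w * 10) * 1 + (2 * n + 3 + y * 5 + x * 10)
          ≡ n * 1 + (5 * (x + y) + x * 5 + w * 10) + (n + 3)
        cert = solve-∀
      ... | inj₁ s | inj₁ v∈V₁ with good-or-attached v
      ...   | inj₂ a = ⊥-elim (true≢false v∈V₁ (not-true⁻ (proj₁ (∧-true⁻ {V₂ v} a))))
      ...   | inj₁ g = linear 10 g (cert (ownDegree G side v) n)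
        where
        cert : ∀ w n → (w * 10) * 10 + n * 39 ≡ n * 10 + w * 100 + 29 * n
        cert = solve-∀
      own≥ v | inj₂ s | inj₁ v∈V₁ = ⊥-elim (true≢false (∨-true⁺ˡ {V₁ v} {moved v} v∈V₁) s)
      own≥ v | inj₂ s | inj₂ v∉V₁ = linear 100 (+-mono-≤ (+-mono-≤ (*-monoˡ-≤ 100 (degrees v)) (*-monoˡ-≤ 500 (≤ᵇ-false {d₂ v} {d₁ v} stayed)))
              (+-mono-≤ (*-monoˡ-≤ 1000 (own-unmoved v s)) attached-few))
              (cert (d₁ v) (d₂ v) (ownDegree G side v) (count attached) n)
        where
        stayed : (d₂ v ≤ᵇ d₁ v) ≡ false
        stayed with bool-cases (d₂ v ≤ᵇ d₁ v)
        ... | inj₂ e = e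
        ... | inj₁ e = ⊥-elim (true≢false (∧-true⁺ (not-true⁺ v∉V₁) e) (proj₂ (∨-false⁻ {V₁ v} s)))
        cert : ∀ x y w b n → (w * 10) * 100 + ((2 * n + 3) * 100 + x * 500 + (y * 1000 + b * 1000))
          ≡ n * 100 + ((5 * (x + y)) * 100 + y * 500 + ((w + b) * 1000 + n)) + (99 * n + 300)
        cert = solve-∀

      -- One part is at most 60001n/100000 because the other is at least 39999n/100000; at most
      -- n/1000 moved vertices are added.
      cell-bound : ∀ {c o u b} → n * 39999 ≤ o * 100000 → c + o ≤ n → u ≤ c + b → b * 1000 ≤ n → u * 100 ≤ n * 61
      cell-bound {c} {o} {u} {b} ho hn hu hb = linear 1000 (+-mono-≤ (+-mono-≤ ho (*-monoˡ-≤ 100000 hn))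
          (+-mono-≤ (*-monoˡ-≤ 100000 hu) (*-monoˡ-≤ 100 hb))) (cert c o u b n)
        where
        cert : ∀ c o u b n → (n * 61) * 1000 + (n * 39999 + (c + o) * 100000 + (u * 100000 + (b * 1000) * 100))
          ≡ (u * 100) * 1000 + (o * 100000 + n * 100000 + ((c + b) * 100000 + n * 100)) + 899 * n
        cert = solve-∀

      cells≤ : ∀ b → count (cell side b) * 100 ≤ n * 61
      cells≤ true = cell-bound {count V₁} {count V₂} {count side} {count attached} big₂ (≤-reflexive (count-compl V₁))
        (≤-trans (count-∪ V₁ moved) (+-monoʳ-≤ (count V₁) (count-mono moved attached moved⇒attached))) attached-few
      cells≤ false = cell-bound {count V₂} {count V₁} {count (compl side)} {0} big₁ (≤-reflexive (trans (+-comm (count V₂) (count V₁)) (count-compl V₁)))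
        (≤-trans (count-mono (compl side) V₂ (λ w e → not-true⁺ (proj₁ (∨-false⁻ {V₁ w} (not-true⁻ e))))) (m≤m+n (count V₂) 0)) z≤n

    halin-from-partition : KConnected 3 G → HasSpanningGenHalin G
    halin-from-partition 3-conn = TwoClusters.halin G side large 3-conn (λ v → ≤-trans (m≤m+n (2 * n) 3) (degree≥ v)) cells≤ own≥ few

-- From rational hypotheses to inequalities between natural numbers

module Fractions where

  import Data.Nat as ℕ
  import Data.Nat.Properties as ℕ
  open import Data.Nat using (ℕ; suc; NonZero)
  open import Data.Integer using (+_)
  import Data.Integer as ℤ
  import Data.Integer.Properties as ℤ
  open import Data.Rational using (ℚ; _/_; _<_; _≤_; _*_; _-_; 0ℚ; toℚᵘ; NonNegative)
  import Data.Rational.Properties as ℚ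
  open import Data.Rational.Unnormalised using (mkℚᵘ; _≃_)
  import Data.Rational.Unnormalised as ℚᵘ
  import Data.Rational.Unnormalised.Properties as ℚᵘ
  open import Relation.Binary.PropositionalEquality
  open import Relation.Nullary.Decidable using (from-yes)

  -- In unnormalised fractions numerators and denominators multiply literally, so that cross
  -- multiplication needs no greatest common divisors.
  toℚᵘ-product : ∀ a b n → toℚᵘ ((+ a / suc b) * (+ n / 1)) ≃ mkℚᵘ (+ a) b ℚᵘ.* mkℚᵘ (+ n) 0
  toℚᵘ-product a b n = ℚᵘ.≃-trans (ℚ.toℚᵘ-homo-* (+ a / suc b) (+ n / 1))
    (ℚᵘ.*-cong (ℚ.toℚᵘ-fromℚᵘ (mkℚᵘ (+ a) b)) (ℚ.toℚᵘ-fromℚᵘ (mkℚᵘ (+ n) 0)))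

  fraction-≤ : ∀ a b .{{_ : NonZero b}} n s → (+ a / b) * (+ n / 1) ≤ + s / 1 → n ℕ.* a ℕ.≤ s ℕ.* b
  fraction-≤ a (suc b) n s h = subst₂ ℕ._≤_ (trans (ℕ.*-identityʳ _) (ℕ.*-comm a n)) (cong (s ℕ.*_) (ℕ.*-identityʳ (suc b)))
    (ℤ.drop‿+≤+ (subst₂ ℤ._≤_ (trans (cong (ℤ._* + 1) (sym (ℤ.pos-* a n))) (sym (ℤ.pos-* (a ℕ.* n) 1)))
      (sym (ℤ.pos-* s (suc b ℕ.* 1)))
      (ℚᵘ.drop-*≤* (ℚᵘ.≤-respˡ-≃ (toℚᵘ-product a b n) (ℚᵘ.≤-respʳ-≃ (ℚ.toℚᵘ-fromℚᵘ (mkℚᵘ (+ s) 0)) (ℚ.toℚᵘ-mono-≤ h))))))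

  ≤-fraction : ∀ a b .{{_ : NonZero b}} n s → + s / 1 ≤ (+ a / b) * (+ n / 1) → s ℕ.* b ℕ.≤ n ℕ.* a
  ≤-fraction a (suc b) n s h = subst₂ ℕ._≤_ (cong (s ℕ.*_) (ℕ.*-identityʳ (suc b))) (trans (ℕ.*-identityʳ _) (ℕ.*-comm a n))
    (ℤ.drop‿+≤+ (subst₂ ℤ._≤_ (sym (ℤ.pos-* s (suc b ℕ.* 1))) (trans (cong (ℤ._* + 1) (sym (ℤ.pos-* a n))) (sym (ℤ.pos-* (a ℕ.* n) 1)))
      (ℚᵘ.drop-*≤* (ℚᵘ.≤-respʳ-≃ (toℚᵘ-product a b n) (ℚᵘ.≤-respˡ-≃ (ℚ.toℚᵘ-fromℚᵘ (mkℚᵘ (+ s) 0)) (ℚ.toℚᵘ-mono-≤ h))))))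

  n/1-nonNeg : ∀ n → NonNegative (+ n / 1)
  n/1-nonNeg n = ℚ.normalize-nonNeg n 1

  -- Chosen so that 2β₀n * n edges across, divided by n/200, allow at most 400β₀n = n/1000 attached
  -- vertices.
  β₀ : ℚ
  β₀ = + 1 / 400000

  module _ {β : ℚ} (β≤β₀ : β ≤ β₀) where

    -- The left side decreases in `β`, so `β` may be replaced by `β₀`, where 2/5 - 4β₀ evaluates to
    -- 39999/100000.
    part-bound : ∀ n s → (+ 2 / 5 - (+ 4 / 1) * β) * (+ n / 1) ≤ + s / 1 → n ℕ.* 39999 ℕ.≤ s ℕ.* 100000
    part-bound n s h = fraction-≤ 39999 100000 n s
      (ℚ.≤-trans (ℚ.*-monoʳ-≤-nonNeg (+ n / 1) {{n/1-nonNeg n}}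
        (ℚ.+-monoʳ-≤ (+ 2 / 5) (ℚ.neg-antimono-≤ (ℚ.*-monoˡ-≤-nonNeg (+ 4 / 1) β≤β₀)))) h)

    cross-bound : ∀ n d → + d / 1 ≤ (+ 2 / 1) * β * (+ n / 1) → d ℕ.* 200000 ℕ.≤ n
    cross-bound n d h = subst (d ℕ.* 200000 ℕ.≤_) (ℕ.*-identityʳ n) (≤-fraction 1 200000 n d
      (ℚ.≤-trans h (ℚ.*-monoʳ-≤-nonNeg (+ n / 1) {{n/1-nonNeg n}} (ℚ.*-monoˡ-≤-nonNeg (+ 2 / 1) β≤β₀))))

  0<β₀ : 0ℚ < β₀
  0<β₀ = from-yes (0ℚ ℚ.<? β₀)

open import Data.Nat using (ℕ) renaming (_+_ to _+ℕ_; _*_ to _*ℕ_; _≤_ to _≤ℕ_)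
open import Data.Integer using (+_)
open import Data.Rational using (ℚ; _/_; _<_; _≤_; _*_; _-_; 0ℚ)
open import Data.Rational.Properties using (positive⁻¹)
open import Data.Product using (Σ; _×_; _,_)
open import Data.Bool using (true)
open import Data.Fin using (Fin)
open import Relation.Binary.PropositionalEquality using (_≡_)

theorem4p2 : Σ ℚ λ α₀ → (0ℚ < α₀) ×
    (∀ (α : ℚ) → 0ℚ < α → α ≤ α₀ →
    Σ ℚ λ β₀ → (0ℚ < β₀) ×
    (∀ (β : ℚ) → 0ℚ < β → β ≤ β₀ →
    Σ ℕ λ n₀ → ∀ (n : ℕ) → n₀ ≤ℕ n →
    ∀ (G : Graph n) → KConnected 3 G →
    (∀ (v : Fin n) → 2 *ℕ n +ℕ 3 ≤ℕ 5 *ℕ degree G v) →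
    ∀ (V₁ : VSet n) →
    ((+ 2 / 5 - (+ 4 / 1) * β) * (+ n / 1) ≤ + size V₁ / 1) →
    ((+ 2 / 5 - (+ 4 / 1) * β) * (+ n / 1) ≤ + size (compl V₁) / 1) →
    (+ eBetween G V₁ / 1 < α * (+ (size V₁ *ℕ size (compl V₁)) / 1)) →
    (∀ (v : Fin n) → V₁ v ≡ true → + degIn G v (compl V₁) / 1 ≤ (+ 2 / 1) * β * (+ n / 1)) →
    HasSpanningGenHalin G))
theorem4p2 = + 1 / 1 , positive⁻¹ (+ 1 / 1) , λ α _ _ → β₀ , 0<β₀ , λ β _ β≤β₀ →
  3000000 , λ n large G 3-conn degree≥ V₁ big₁ big₂ _ sparse →
    halin-from-partition G V₁ large degree≥ (part-bound β≤β₀ n (size V₁) big₁) (part-bound β≤β₀ n (size (compl V₁)) big₂)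
      (λ v v∈V₁ → cross-bound β≤β₀ n (degIn G v (compl V₁)) (sparse v v∈V₁)) 3-conn
  where
  open Halin.Reassignment
  open Fractions
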